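{- Let $\succeq$ be a quasi-order on classical terms whose induced strict order $\succ$ is a well-founded rewrite order. Then any Superposed Term Rewrite System (STRS) compatible with $\succ_w$, the strict order associated with the worst path extension $\succeq_w$ of $\succeq$, terminates.
   Context: **Syntax.** $\mathcal X$ is a countable set of variables; $\mathcal A,\mathcal C,\mathcal F$ are pairwise disjoint signatures (symbols $b$ with arity $\mathrm{ar}(b)\in\mathbb N$) of amplitude, constructor and function symbols. Constructors include a unit $()$, $|0\rangle$, $|1\rangle$, $\mathtt 0$ (arity 0), $\mathtt S$ (arity 1), pairing $(\cdot,\cdot)$ (arity 2), $[\,]$ (arity 0) and list-cons $h::t$ (arity 2). Grammar: naturals $\iota::=x\mid\mathtt 0\mid\mathtt S(\iota)$; amplitudes $\alpha::=\mathtt a(\iota,\dots,\iota)\mid\alpha\cdot\alpha\mid\alpha+\alpha$; terms $t::=x\mid c(t,\dots,t)\mid f(t,\dots,t)\mid\alpha\cdot t\mid t+t$; values $v::=c(v,\dots,v)\mid\alpha\cdot v\ (\alpha\text{ ground})\mid v+v$. A term or amplitude is ground if it has no variable; $\mathscr T_0$ is the set of ground terms. A term is classical if it contains neither $+$ nor $\alpha\cdot$. A substitution $\sigma$ maps variables to values. **Amplitudes.** Each $\mathtt a\in\mathcal A$ has a total interpretation $[\![\mathtt a]\!]:\mathbb N^{\mathrm{ar}(\mathtt a)}\to\mathbb C$, extended to ground amplitudes in the obvious way (sums to sums, products to products, $\mathtt S^n(\mathtt 0)$ to $n$). For a non-ground $\alpha$, $[\![\alpha]\!]=\lambda$ means $[\![\alpha\sigma]\!]=\lambda$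 for every $\sigma$ such that $\alpha\sigma$ is a ground amplitude. **Equivalence.** $\equiv$ is the smallest equivalence relation on terms, closed under all term contexts ($s\equiv t\Rightarrow C[s]\equiv C[t]$), with: $t_1+t_2\equiv t_2+t_1$; $t_1+(t_2+t_3)\equiv(t_1+t_2)+t_3$; $s+\alpha\cdot t\equiv s$ if $[\![\alpha]\!]=0$; $\alpha\cdot t\equiv t$ if $[\![\alpha]\!]=1$; $\alpha\cdot(\beta\cdot t)\equiv(\alpha\cdot\beta)\cdot t$; $\alpha\cdot(t_1+t_2)\equiv\alpha\cdot t_1+\alpha\cdot t_2$; $\alpha\cdot t+\beta\cdot t\equiv(\alpha+\beta)\cdot t$; and, for $b\in\mathcal C\uplus\mathcal F$, $b(\dots,\alpha\cdot t,\dots)\equiv\alpha\cdot b(\dots,t,\dots)$ and $b(\dots,t_1+t_2,\dots)\equiv b(\dots,t_1,\dots)+b(\dots,t_2,\dots)$. A canonical form of $t$ is a term $\sum_{i=1}^n\alpha_i\cdot t_i\equiv t$ with the $t_i$ pairwise distinct classical terms and $[\![\alpha_i]\!]\neq0$; $\mathrm{CAN}$ is the set of canonical forms. **STRS.** A rewrite rule is $l\to r$ with $l=f(p_1,\dots,p_n)$, $f\in\mathcal F$, each $p_i$ a classical term without function symbols, and $\mathrm{Var}(r)\subseteq\mathrm{Var}(l)$. An STRS $\mathfrak R$ consists of $\mathcal A,\mathcal C,\mathcal F,\mathcal X$, a set $\mathcal R$ of orthogonal rules (left-linear and with pairwise non-overlapping left-hand sides), and a main symbol $f\in\mathcal F$.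 **Reduction.** Evaluation contexts: $E::=\diamond\mid b(v_1,\dots,v_{i-1},E,t_{i+1},\dots,t_n)$ with $b\in\mathcal C\uplus\mathcal F$ and $v_j$ values. $\to_{\mathfrak R}\subseteq\mathscr T_0\times\mathscr T_0$ is defined inductively by: (C) if $l\to r\in\mathcal R$ and $E[l\sigma]$ is classical then $E[l\sigma]\to_{\mathfrak R}E[r\sigma]$; (E) if $s\equiv s'\to_{\mathfrak R}t'\equiv t$ then $s\to_{\mathfrak R}t$; (Q) if $\sum_i\alpha_i\cdot s_i\in\mathrm{CAN}$, $s_i\to^?_{\mathfrak R}t_i$ for all $i$, and $s_i\to_{\mathfrak R}t_i$ for some $i$, then $\sum_i\alpha_i\cdot s_i\to_{\mathfrak R}\sum_i\alpha_i\cdot t_i$. Here $s\to^?_{\mathfrak R}t$ iff ($s\in\mathrm{NF}_{\mathfrak R}$ and $t=s$) or $s\to_{\mathfrak R}t$, and $\mathrm{NF}_{\mathfrak R}$ is the set of ground terms with no $\to_{\mathfrak R}$-reduct. A term terminates if, for some $k\in\mathbb N$, all reduction chains from it reach a normal form in at most $k$ steps; an STRS terminates if every ground term terminates. **Orders.** A quasi-order $\succeq$ is a reflexive transitive relation; its strict order is $s\succ t\iff s\succeq t\wedge\neg(t\succeq s)$. $\succ$ is well-founded if there is no infinite chain $t_1\succ t_2\succ\cdots$. An order is monotonic if $s\succ t$ implies $b(\dots,s,\dots)\succ b(\dots,t,\dots)$ for all $b\in\mathcal C\uplus\mathcal F$; closed under substitutions if $s\succ t$ implies $s\sigma\succ t\sigma$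 for every substitution $\sigma$ (mapping variables to classical values); a rewrite order is a monotonic order closed under substitutions. An STRS is compatible with a strict order $\succ$ if $l\succ r$ for all its rules $l\to r$. The worst path extension $\succeq_w$ of a quasi-order $\succeq$ on classical terms is defined inductively on terms by: $s\succeq_wt$ if $s,t$ are classical and $s\succeq t$; $s\succeq_wt$ if $s\equiv\sum_{i=1}^n\alpha_i\cdot s_i\in\mathrm{CAN}$ and $s_i\succeq_wt$ for some $i$; $s\succeq_wt$ if $t\equiv\sum_{j=1}^m\beta_j\cdot t_j\in\mathrm{CAN}$ and $s\succeq_wt_j$ for all $j$. -}

module Defs where

open import Data.Fin using (Fin; zero; suc; _<_)
open import Data.List using (List; []; _∷_; _++_)
open import Data.List.Relation.Binary.Subset.Propositional using (_⊆_)
open import Data.List.Relation.Unary.Unique.Propositional using (Unique)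
open import Data.Nat using (ℕ; zero; suc; _≤_; _⊔_)
import Data.Nat.Properties as ℕₚ
open import Data.Product using (∃; ∃₂; _×_; _,_)
open import Data.Rational as ℚ using (ℚ; 0ℚ; 1ℚ; ½)
import Data.Rational.Properties as ℚₚ
open import Data.Rational.Solver using (module +-*-Solver)
open import Data.Sum using (_⊎_; inj₁; inj₂; [_,_]′)
open import Data.Vec using (Vec; []; _∷_; lookup; map; _[_]≔_)
open import Data.Vec.Relation.Binary.Pointwise.Inductive using (Pointwise)
open import Data.Vec.Relation.Unary.All using (All)
open import Function using (_∘_; _⇔_; _↣_)
open import Function.Definitions using (Injective)
open import Induction.InfiniteDescent using (InfiniteDescendingSequence)
open import Level using (0ℓ)
open import Relation.Binary using (Rel)
open import Relation.Binary.PropositionalEquality using (_≡_; refl; sym; cong; subst)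
open import Relation.Nullary using (¬_)
open import Relation.Unary using (Pred)

-- The complex numbers, as pairs of real numbers; the reals are the
-- (not quotiented) Cauchy sequences of rationals, with equality _≈_.

module Real where

  record ℝ : Set where
    no-eta-equality
    constructor mkℝ
    field
      seq    : ℕ → ℚ
      cauchy : ∀ ε → 0ℚ ℚ.< ε →
               ∃ λ N → ∀ m n → N ≤ m → N ≤ n → ℚ.∣ seq m ℚ.- seq n ∣ ℚ.< ε

  open ℝ public

  infix 4 _≈_

  _≈_ : Rel ℝ 0ℓ
  x ≈ y = ∀ ε → 0ℚ ℚ.< ε →
          ∃ λ N → ∀ n → N ≤ n → ℚ.∣ seq x n ℚ.- seq y n ∣ ℚ.< ε

  0<½* : ∀ {ε} → 0ℚ ℚ.< ε → 0ℚ ℚ.< ½ ℚ.* ε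
  0<½* {ε} 0<ε = subst (ℚ._< ½ ℚ.* ε) (ℚₚ.*-zeroʳ ½) (ℚₚ.*-monoʳ-<-pos ½ 0<ε)

  ½+½ : ∀ ε → ½ ℚ.* ε ℚ.+ ½ ℚ.* ε ≡ ε
  ½+½ ε = begin
    ½ ℚ.* ε ℚ.+ ½ ℚ.* ε ≡⟨ sym (ℚₚ.*-distribʳ-+ ε ½ ½) ⟩
    1ℚ ℚ.* ε            ≡⟨ ℚₚ.*-identityˡ ε ⟩
    ε                   ∎
    where open Relation.Binary.PropositionalEquality.≡-Reasoning

  eventually-bounded : ∀ x → ∃₂ λ B N → 0ℚ ℚ.< B × (∀ n → N ≤ n → ℚ.∣ seq x n ∣ ℚ.< B)
  eventually-bounded x with cauchy x 1ℚ (ℚₚ.positive⁻¹ 1ℚ)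
  ... | N , close = 1ℚ ℚ.+ ℚ.∣ seq x N ∣ , N , 0<B , bound
    where
    open ℚₚ.≤-Reasoning
    bound : ∀ n → N ≤ n → ℚ.∣ seq x n ∣ ℚ.< 1ℚ ℚ.+ ℚ.∣ seq x N ∣
    bound n N≤n = begin-strict
      ℚ.∣ seq x n ∣
        ≡⟨ cong ℚ.∣_∣ (solve 2 (λ a b → a := (a :- b) :+ b) refl (seq x n) (seq x N)) ⟩
      ℚ.∣ (seq x n ℚ.- seq x N) ℚ.+ seq x N ∣
        ≤⟨ ℚₚ.∣p+q∣≤∣p∣+∣q∣ (seq x n ℚ.- seq x N) (seq x N) ⟩
      ℚ.∣ seq x n ℚ.- seq x N ∣ ℚ.+ ℚ.∣ seq x N ∣
        <⟨ ℚₚ.+-monoˡ-< ℚ.∣ seq x N ∣ (close n N N≤n ℕₚ.≤-refl) ⟩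
      1ℚ ℚ.+ ℚ.∣ seq x N ∣ ∎
      where open +-*-Solver
    0<B : 0ℚ ℚ.< 1ℚ ℚ.+ ℚ.∣ seq x N ∣
    0<B = ℚₚ.≤-<-trans (ℚₚ.0≤∣p∣ (seq x N)) (bound N ℕₚ.≤-refl)

  -- For δ > 0 and B > 0, some η > 0 satisfies B η = δ.
  scale : ∀ δ B → 0ℚ ℚ.< δ → 0ℚ ℚ.< B → ∃ λ η → 0ℚ ℚ.< η × B ℚ.* η ≡ δ
  scale δ B 0<δ 0<B = η , 0<η , Bη≡δ
    where
    instance
      B>0 : ℚ.Positive B
      B>0 = ℚ.positive 0<B
      B≢0 : ℚ.NonZero B
      B≢0 = ℚₚ.pos⇒nonZero B
      1/B>0 : ℚ.Positive (ℚ.1/ B)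
      1/B>0 = ℚₚ.1/pos⇒pos B
    η = (ℚ.1/ B) ℚ.* δ
    0<η : 0ℚ ℚ.< η
    0<η = subst (ℚ._< η) (ℚₚ.*-zeroʳ (ℚ.1/ B)) (ℚₚ.*-monoʳ-<-pos (ℚ.1/ B) 0<δ)
    open Relation.Binary.PropositionalEquality.≡-Reasoning
    Bη≡δ : B ℚ.* η ≡ δ
    Bη≡δ = begin
      B ℚ.* (ℚ.1/ B ℚ.* δ) ≡⟨ sym (ℚₚ.*-assoc B (ℚ.1/ B) δ) ⟩
      (B ℚ.* ℚ.1/ B) ℚ.* δ ≡⟨ cong (ℚ._* δ) (ℚₚ.*-inverseʳ B) ⟩
      1ℚ ℚ.* δ             ≡⟨ ℚₚ.*-identityˡ δ ⟩
      δ                    ∎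

  *-bound : ∀ {p q B η} → 0ℚ ℚ.< B → ℚ.∣ p ∣ ℚ.< B → ℚ.∣ q ∣ ℚ.< η →
            ℚ.∣ p ∣ ℚ.* ℚ.∣ q ∣ ℚ.< B ℚ.* η
  *-bound {p} {q} {B} {η} 0<B p<B q<η = begin-strict
    ℚ.∣ p ∣ ℚ.* ℚ.∣ q ∣ ≤⟨ ℚₚ.*-monoʳ-≤-nonNeg ℚ.∣ q ∣ {{ℚₚ.∣-∣-nonNeg q}} (ℚₚ.<⇒≤ p<B) ⟩
    B ℚ.* ℚ.∣ q ∣       <⟨ ℚₚ.*-monoʳ-<-pos B {{ℚ.positive 0<B}} q<η ⟩
    B ℚ.* η             ∎
    where open ℚₚ.≤-Reasoning

  fromℚ : ℚ → ℝ
  fromℚ q = mkℝ (λ _ → q) λ ε 0<ε → 0 , λ _ _ _ _ →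
    subst (λ p → ℚ.∣ p ∣ ℚ.< ε) (sym (ℚₚ.+-inverseʳ q)) 0<ε

  infixl 6 _+_
  infixl 7 _*_
  infix  8 -_

  _+_ : ℝ → ℝ → ℝ
  x + y = mkℝ (λ n → seq x n ℚ.+ seq y n) λ ε 0<ε →
    let N₁ , close₁ = cauchy x (½ ℚ.* ε) (0<½* 0<ε)
        N₂ , close₂ = cauchy y (½ ℚ.* ε) (0<½* 0<ε)
    in N₁ ⊔ N₂ , λ m n N≤m N≤n → begin-strict
      ℚ.∣ (seq x m ℚ.+ seq y m) ℚ.- (seq x n ℚ.+ seq y n) ∣
        ≡⟨ cong ℚ.∣_∣ (solve 4 (λ a b c d → (a :+ b) :- (c :+ d) := (a :- c) :+ (b :- d))
             refl (seq x m) (seq y m) (seq x n) (seq y n)) ⟩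
      ℚ.∣ (seq x m ℚ.- seq x n) ℚ.+ (seq y m ℚ.- seq y n) ∣
        ≤⟨ ℚₚ.∣p+q∣≤∣p∣+∣q∣ (seq x m ℚ.- seq x n) (seq y m ℚ.- seq y n) ⟩
      ℚ.∣ seq x m ℚ.- seq x n ∣ ℚ.+ ℚ.∣ seq y m ℚ.- seq y n ∣
        <⟨ ℚₚ.+-mono-<
             (close₁ m n (ℕₚ.m⊔n≤o⇒m≤o N₁ N₂ N≤m) (ℕₚ.m⊔n≤o⇒m≤o N₁ N₂ N≤n))
             (close₂ m n (ℕₚ.m⊔n≤o⇒n≤o N₁ N₂ N≤m) (ℕₚ.m⊔n≤o⇒n≤o N₁ N₂ N≤n)) ⟩
      ½ ℚ.* ε ℚ.+ ½ ℚ.* ε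
        ≡⟨ ½+½ ε ⟩
      ε ∎
    where
    open ℚₚ.≤-Reasoning
    open +-*-Solver

  -_ : ℝ → ℝ
  - x = mkℝ (λ n → ℚ.- seq x n) λ ε 0<ε →
    let N , close = cauchy x ε 0<ε
    in N , λ m n N≤m N≤n → begin-strict
      ℚ.∣ ℚ.- seq x m ℚ.- ℚ.- seq x n ∣
        ≡⟨ cong ℚ.∣_∣ (solve 2 (λ a b → :- a :- :- b := b :- a) refl (seq x m) (seq x n)) ⟩
      ℚ.∣ seq x n ℚ.- seq x m ∣
        <⟨ close n m N≤n N≤m ⟩
      ε ∎
    where
    open ℚₚ.≤-Reasoning
    open +-*-Solver

  _*_ : ℝ → ℝ → ℝ
  x * y = mkℝ (λ n → seq x n ℚ.* seq y n) λ ε 0<ε →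
    let B , M₁ , 0<B , x<B = eventually-bounded x
        C , M₂ , 0<C , y<C = eventually-bounded y
        η , 0<η , Bη≡ε/2   = scale (½ ℚ.* ε) B (0<½* 0<ε) 0<B
        θ , 0<θ , Cθ≡ε/2   = scale (½ ℚ.* ε) C (0<½* 0<ε) 0<C
        N₁ , y-close       = cauchy y η 0<η
        N₂ , x-close       = cauchy x θ 0<θ
        M = M₁ ⊔ M₂
        N = N₁ ⊔ N₂
    in M ⊔ N , λ m n ≤m ≤n →
      let M≤m = ℕₚ.m⊔n≤o⇒m≤o M N ≤m
          M≤n = ℕₚ.m⊔n≤o⇒m≤o M N ≤n
          N≤m = ℕₚ.m⊔n≤o⇒n≤o M N ≤m
          N≤n = ℕₚ.m⊔n≤o⇒n≤o M N ≤n
          Δx  = seq x m ℚ.- seq x n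
          Δy  = seq y m ℚ.- seq y n
      in begin-strict
      ℚ.∣ seq x m ℚ.* seq y m ℚ.- seq x n ℚ.* seq y n ∣
        ≡⟨ cong ℚ.∣_∣ (solve 4 (λ a b c d → a :* b :- c :* d := a :* (b :- d) :+ d :* (a :- c))
             refl (seq x m) (seq y m) (seq x n) (seq y n)) ⟩
      ℚ.∣ seq x m ℚ.* Δy ℚ.+ seq y n ℚ.* Δx ∣
        ≤⟨ ℚₚ.∣p+q∣≤∣p∣+∣q∣ (seq x m ℚ.* Δy) (seq y n ℚ.* Δx) ⟩
      ℚ.∣ seq x m ℚ.* Δy ∣ ℚ.+ ℚ.∣ seq y n ℚ.* Δx ∣
        ≡⟨ cong (ℚ._+ ℚ.∣ seq y n ℚ.* Δx ∣) (ℚₚ.∣p*q∣≡∣p∣*∣q∣ (seq x m) Δy) ⟩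
      ℚ.∣ seq x m ∣ ℚ.* ℚ.∣ Δy ∣ ℚ.+ ℚ.∣ seq y n ℚ.* Δx ∣
        ≡⟨ cong (ℚ.∣ seq x m ∣ ℚ.* ℚ.∣ Δy ∣ ℚ.+_) (ℚₚ.∣p*q∣≡∣p∣*∣q∣ (seq y n) Δx) ⟩
      ℚ.∣ seq x m ∣ ℚ.* ℚ.∣ Δy ∣ ℚ.+ ℚ.∣ seq y n ∣ ℚ.* ℚ.∣ Δx ∣
        <⟨ ℚₚ.+-mono-<
             (*-bound {seq x m} {Δy} 0<B (x<B m (ℕₚ.m⊔n≤o⇒m≤o M₁ M₂ M≤m))
               (y-close m n (ℕₚ.m⊔n≤o⇒m≤o N₁ N₂ N≤m) (ℕₚ.m⊔n≤o⇒m≤o N₁ N₂ N≤n)))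
             (*-bound {seq y n} {Δx} 0<C (y<C n (ℕₚ.m⊔n≤o⇒n≤o M₁ M₂ M≤n))
               (x-close m n (ℕₚ.m⊔n≤o⇒n≤o N₁ N₂ N≤m) (ℕₚ.m⊔n≤o⇒n≤o N₁ N₂ N≤n))) ⟩
      B ℚ.* η ℚ.+ C ℚ.* θ
        ≡⟨ cong (ℚ._+ C ℚ.* θ) Bη≡ε/2 ⟩
      ½ ℚ.* ε ℚ.+ C ℚ.* θ
        ≡⟨ cong (½ ℚ.* ε ℚ.+_) Cθ≡ε/2 ⟩
      ½ ℚ.* ε ℚ.+ ½ ℚ.* ε
        ≡⟨ ½+½ ε ⟩
      ε ∎
    where
    open ℚₚ.≤-Reasoning
    open +-*-Solver

module Complex where

  open Real using (ℝ; fromℚ)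

  record ℂ : Set where
    no-eta-equality
    constructor _+i_
    field
      re im : ℝ

  open ℂ public

  infix  4 _≈_
  infixl 6 _+_
  infixl 7 _*_

  _≈_ : Rel ℂ 0ℓ
  z ≈ w = re z Real.≈ re w × im z Real.≈ im w

  0ℂ 1ℂ : ℂ
  0ℂ = fromℚ 0ℚ +i fromℚ 0ℚ
  1ℂ = fromℚ 1ℚ +i fromℚ 0ℚ

  _+_ _*_ : ℂ → ℂ → ℂ
  z + w = (re z Real.+ re w) +i (im z Real.+ im w)
  z * w = (re z Real.* re w Real.+ Real.- (im z Real.* im w))
       +i (re z Real.* im w Real.+ im z Real.* re w)

open Complex using (ℂ; 0ℂ; 1ℂ; _≈_)

data Constructor (C : Set) : Set where
  ⟨⟩ ∣0⟩ ∣1⟩ 𝟎 𝐒 pair nil cons : Constructor C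
  other                         : C → Constructor C

-- The disjointness of the sets of symbols is implicit in their being separate
-- types. The constructors are the mandatory ones together with OtherCon.

record Signature : Set₁ where
  field
    Variable          : Set
    variableCountable : Variable ↣ ℕ
    Amp               : Set
    arᴬ               : Amp → ℕ
    interp            : (a : Amp) → Vec ℕ (arᴬ a) → ℂ
    OtherCon          : Set
    arᴼ               : OtherCon → ℕ
    Fun               : Set
    arᶠ               : Fun → ℕ

  Con : Set
  Con = Constructor OtherCon

  arᶜ : Con → ℕ
  arᶜ ⟨⟩        = 0
  arᶜ ∣0⟩       = 0
  arᶜ ∣1⟩       = 0
  arᶜ 𝟎         = 0
  arᶜ 𝐒         = 1
  arᶜ pair      = 2
  arᶜ nil       = 0
  arᶜ cons      = 2
  arᶜ (other c) = arᴼ c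

  Symbol : Set
  Symbol = Con ⊎ Fun

  ar : Symbol → ℕ
  ar = [ arᶜ , arᶠ ]′

module Syntax (Sig : Signature) where

  open Signature Sig public

  data Natural : Set where
    var  : Variable → Natural
    zero : Natural
    suc  : Natural → Natural

  infixr 7 _·_
  infixl 6 _⊕_

  data Amplitude : Set where
    amp : (a : Amp) → Vec Natural (arᴬ a) → Amplitude
    _·_ : Amplitude → Amplitude → Amplitude
    _⊕_ : Amplitude → Amplitude → Amplitude

  data Term : Set where
    var : Variable → Term
    app : (b : Symbol) → Vec Term (ar b) → Term
    _·_ : Amplitude → Term → Term
    _⊕_ : Term → Term → Term

  -- Classical terms: the terms containing neither _⊕_ nor _·_. They are
  -- included among all terms by ⌜_⌝.

  data ClassicalTerm : Set where
    var : Variable → ClassicalTerm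
    app : (b : Symbol) → Vec ClassicalTerm (ar b) → ClassicalTerm

  mutual
    ⌜_⌝ : ClassicalTerm → Term
    ⌜ var x ⌝    = var x
    ⌜ app b ts ⌝ = app b ⌜ ts ⌝*

    ⌜_⌝* : ∀ {n} → Vec ClassicalTerm n → Vec Term n
    ⌜ [] ⌝*     = []
    ⌜ t ∷ ts ⌝* = ⌜ t ⌝ ∷ ⌜ ts ⌝*

  Classical : Pred Term 0ℓ
  Classical t = ∃ λ c → t ≡ ⌜ c ⌝

  ⌊_⌋ : Natural → Term
  ⌊ var x ⌋ = var x
  ⌊ zero ⌋  = app (inj₁ 𝟎) []
  ⌊ suc ι ⌋ = app (inj₁ 𝐒) (⌊ ι ⌋ ∷ [])

  -- Variables, listed with multiplicity.

  varsᴺ : Natural → List Variable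
  varsᴺ (var x) = x ∷ []
  varsᴺ zero    = []
  varsᴺ (suc ι) = varsᴺ ι

  varsᴺ* : ∀ {n} → Vec Natural n → List Variable
  varsᴺ* []       = []
  varsᴺ* (ι ∷ ιs) = varsᴺ ι ++ varsᴺ* ιs

  varsᴬ : Amplitude → List Variable
  varsᴬ (amp a ιs) = varsᴺ* ιs
  varsᴬ (α · β)    = varsᴬ α ++ varsᴬ β
  varsᴬ (α ⊕ β)    = varsᴬ α ++ varsᴬ β

  mutual
    vars : Term → List Variable
    vars (var x)    = x ∷ []
    vars (app b ts) = vars* ts
    vars (α · t)    = varsᴬ α ++ vars t
    vars (s ⊕ t)    = vars s ++ vars t

    vars* : ∀ {n} → Vec Term n → List Variable
    vars* []       = []
    vars* (t ∷ ts) = vars t ++ vars* ts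

  GroundAmplitude : Pred Amplitude 0ℓ
  GroundAmplitude α = varsᴬ α ≡ []

  Ground : Pred Term 0ℓ
  Ground t = vars t ≡ []

  data Value : Pred Term 0ℓ where
    con : ∀ c {vs} → All Value vs → Value (app (inj₁ c) vs)
    _·_ : ∀ {α v} → GroundAmplitude α → Value v → Value (α · v)
    _⊕_ : ∀ {v w} → Value v → Value w → Value (v ⊕ w)

  -- "t [ σ ]↦ t′" means tσ = t′. Applying σ is a partial operation: an amplitude
  -- symbol only accepts naturals, so tσ is a term only if σ sends every variable
  -- occurring in an amplitude of t to (the inclusion of) a natural.

  Assignment : Set
  Assignment = Variable → Term

  infix 4 _[_]↦ᴺ_ _[_]↦ᴬ_ _[_]↦_

  data _[_]↦ᴺ_ : Natural → Assignment → Natural → Set where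
    var  : ∀ {σ x ι} → σ x ≡ ⌊ ι ⌋ → var x [ σ ]↦ᴺ ι
    zero : ∀ {σ} → zero [ σ ]↦ᴺ zero
    suc  : ∀ {σ ι ι′} → ι [ σ ]↦ᴺ ι′ → suc ι [ σ ]↦ᴺ suc ι′

  data _[_]↦ᴬ_ : Amplitude → Assignment → Amplitude → Set where
    amp : ∀ {σ a ιs ιs′} → Pointwise (_[ σ ]↦ᴺ_) ιs ιs′ → amp a ιs [ σ ]↦ᴬ amp a ιs′
    _·_ : ∀ {σ α α′ β β′} → α [ σ ]↦ᴬ α′ → β [ σ ]↦ᴬ β′ → α · β [ σ ]↦ᴬ α′ · β′
    _⊕_ : ∀ {σ α α′ β β′} → α [ σ ]↦ᴬ α′ → β [ σ ]↦ᴬ β′ → α ⊕ β [ σ ]↦ᴬ α′ ⊕ β′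

  data _[_]↦_ : Term → Assignment → Term → Set where
    var : ∀ {σ x} → var x [ σ ]↦ σ x
    app : ∀ {σ b ts ts′} → Pointwise (_[ σ ]↦_) ts ts′ → app b ts [ σ ]↦ app b ts′
    _·_ : ∀ {σ α α′ t t′} → α [ σ ]↦ᴬ α′ → t [ σ ]↦ t′ → α · t [ σ ]↦ α′ · t′
    _⊕_ : ∀ {σ s s′ t t′} → s [ σ ]↦ s′ → t [ σ ]↦ t′ → s ⊕ t [ σ ]↦ s′ ⊕ t′

  IsSubstitution : Pred Assignment 0ℓ
  IsSubstitution σ = ∀ x → Value (σ x)

  IsClassicalSubstitution : Pred Assignment 0ℓ
  IsClassicalSubstitution σ = ∀ x → Value (σ x) × Classical (σ x)

  -- Interpretation of ground amplitudes. The value chosen for variables is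
  -- junk: ⟦_⟧ is only ever used on ground amplitudes.

  ⟦_⟧ᴺ : Natural → ℕ
  ⟦ var x ⟧ᴺ = 0
  ⟦ zero ⟧ᴺ  = 0
  ⟦ suc ι ⟧ᴺ = suc ⟦ ι ⟧ᴺ

  ⟦_⟧ : Amplitude → ℂ
  ⟦ amp a ιs ⟧ = interp a (map ⟦_⟧ᴺ ιs)
  ⟦ α · β ⟧    = ⟦ α ⟧ Complex.* ⟦ β ⟧
  ⟦ α ⊕ β ⟧    = ⟦ α ⟧ Complex.+ ⟦ β ⟧

  infix 4 ⟦_⟧≐_

  ⟦_⟧≐_ : Amplitude → ℂ → Set
  ⟦ α ⟧≐ z = ∀ σ → IsSubstitution σ → ∀ α′ → α [ σ ]↦ᴬ α′ → GroundAmplitude α′ → ⟦ α′ ⟧ ≈ z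

  infix 4 _≋_

  -- b(…,t,…), with t at position i, is written app b (ts [ i ]≔ t).

  data _≋_ : Rel Term 0ℓ where
    ≋-refl   : ∀ {t} → t ≋ t
    ≋-sym    : ∀ {s t} → s ≋ t → t ≋ s
    ≋-trans  : ∀ {s t u} → s ≋ t → t ≋ u → s ≋ u
    app-cong : ∀ b ts i {s t} → s ≋ t → app b (ts [ i ]≔ s) ≋ app b (ts [ i ]≔ t)
    ·-cong   : ∀ α {s t} → s ≋ t → α · s ≋ α · t
    ⊕-congˡ  : ∀ u {s t} → s ≋ t → u ⊕ s ≋ u ⊕ t
    ⊕-congʳ  : ∀ u {s t} → s ≋ t → s ⊕ u ≋ t ⊕ u
    ⊕-comm   : ∀ t₁ t₂ → t₁ ⊕ t₂ ≋ t₂ ⊕ t₁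
    ⊕-assoc  : ∀ t₁ t₂ t₃ → t₁ ⊕ (t₂ ⊕ t₃) ≋ (t₁ ⊕ t₂) ⊕ t₃
    ·-zero   : ∀ s α t → ⟦ α ⟧≐ 0ℂ → s ⊕ α · t ≋ s
    ·-one    : ∀ α t → ⟦ α ⟧≐ 1ℂ → α · t ≋ t
    ·-assoc  : ∀ α β t → α · (β · t) ≋ (α · β) · t
    ·-distˡ  : ∀ α t₁ t₂ → α · (t₁ ⊕ t₂) ≋ α · t₁ ⊕ α · t₂
    ·-distʳ  : ∀ α β t → α · t ⊕ β · t ≋ (α ⊕ β) · t
    app-·    : ∀ b ts i α t → app b (ts [ i ]≔ (α · t)) ≋ α · app b (ts [ i ]≔ t)
    app-⊕    : ∀ b ts i t₁ t₂ →
               app b (ts [ i ]≔ (t₁ ⊕ t₂)) ≋ app b (ts [ i ]≔ t₁) ⊕ app b (ts [ i ]≔ t₂)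

  -- The (never empty) sum of the α i · t i, associated to the right.

  ∑ : ∀ {n} → (Fin (suc n) → Amplitude) → (Fin (suc n) → Term) → Term
  ∑ {zero}  α t = α zero · t zero
  ∑ {suc n} α t = α zero · t zero ⊕ ∑ (α ∘ suc) (t ∘ suc)

  -- ∑ α (⌜_⌝ ∘ t) is in CAN. For a non-ground amplitude, being different from 0
  -- is the negation of being equal to 0 in the sense of ⟦_⟧≐_.

  record Canonical {n} (α : Fin (suc n) → Amplitude) (t : Fin (suc n) → ClassicalTerm) : Set where
    field
      distinct : Injective _≡_ _≡_ t
      nonzero  : ∀ i → ¬ (⟦ α i ⟧≐ 0ℂ)

  data Pattern : Pred Term 0ℓ where
    var : ∀ x → Pattern (var x)
    con : ∀ c {ps} → All Pattern ps → Pattern (app (inj₁ c) ps)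

  record IsRule (l r : Term) : Set where
    field
      f        : Fun
      ps       : Vec Term (arᶠ f)
      lhs      : l ≡ app (inj₂ f) ps
      patterns : All Pattern ps
      varsr⊆l  : vars r ⊆ vars l

  -- Non-variable subterms of a term (all that is needed of the subterms of a
  -- left-hand side, which is classical).

  data NonVariableSubterm : Term → Term → Set where
    here  : ∀ {b ts} → NonVariableSubterm (app b ts) (app b ts)
    there : ∀ {u b} ts i → NonVariableSubterm u (lookup ts i) → NonVariableSubterm u (app b ts)

  record STRS : Set₁ where
    field
      Rules      : Rel Term 0ℓ
      isRule     : ∀ {l r} → Rules l r → IsRule l r
      leftLinear : ∀ {l r} → Rules l r → Unique (vars l)
      -- If l′ unifies, after renaming apart, with a non-variable subterm u of l,
      -- then u is l and the two rules are the same one.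
      nonOverlapping : ∀ {l r l′ r′ u} → Rules l r → Rules l′ r′ → NonVariableSubterm u l →
                       ∀ {σ τ w} → u [ σ ]↦ w → l′ [ τ ]↦ w → u ≡ l × l ≡ l′ × r ≡ r′
      main       : Fun

  -- The argument at the position i of the hole in ts is irrelevant.

  data EvaluationContext : Set where
    ◇   : EvaluationContext
    app : ∀ b (ts : Vec Term (ar b)) (i : Fin (ar b)) →
          (∀ j → j < i → Value (lookup ts j)) → EvaluationContext → EvaluationContext

  plug : EvaluationContext → Term → Term
  plug ◇                t = t
  plug (app b ts i _ E) t = app b (ts [ i ]≔ plug E t)

  NormalForm : Rel Term 0ℓ → Pred Term 0ℓ
  NormalForm _⟶_ s = Ground s × ¬ (∃ λ t → s ⟶ t)

  module _ (R : STRS) where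

    open STRS R

    -- The relation generated by the three reduction rules, when the normal forms
    -- that may stay unchanged in a superposition are those given by NF.

    data Step (NF : Pred Term 0ℓ) : Rel Term 0ℓ where
      ruleC : ∀ {l r σ l′ r′} E → Rules l r → IsSubstitution σ → l [ σ ]↦ l′ → r [ σ ]↦ r′ →
              Classical (plug E l′) → Ground (plug E l′) → Ground (plug E r′) →
              Step NF (plug E l′) (plug E r′)
      ruleE : ∀ {s s′ t′ t} → s ≋ s′ → Step NF s′ t′ → t′ ≋ t → Ground s → Ground t → Step NF s t
      ruleQ : ∀ {n} {α : Fin (suc n) → Amplitude} {s : Fin (suc n) → ClassicalTerm}
              {t : Fin (suc n) → Term} → Canonical α s →
              (∀ i → (NF ⌜ s i ⌝ × t i ≡ ⌜ s i ⌝) ⊎ Step NF ⌜ s i ⌝ (t i)) →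
              (∃ λ i → Step NF ⌜ s i ⌝ (t i)) →
              Ground (∑ α (⌜_⌝ ∘ s)) → Ground (∑ α t) →
              Step NF (∑ α (⌜_⌝ ∘ s)) (∑ α t)

    -- The definition of the reduction relation refers, negatively, to its own
    -- normal forms, so it is not an inductive definition in Agda's sense. The
    -- reduction relation is therefore specified as the relation inductively
    -- generated by the rules in which NF is the set of its own normal forms.
    -- Exactly one relation satisfies this, up to ⇔: NF only matters on classical
    -- terms; the canonical forms of a classical term t have t as only summand, so
    -- t has a reduct if and only if it is the source of an instance of ruleC.

    IsReduction : Rel Term 0ℓ → Set
    IsReduction _⟶_ = ∀ s t → s ⟶ t ⇔ Step (NormalForm _⟶_) s t

  data Chain (_⟶_ : Rel Term 0ℓ) : ℕ → Rel Term 0ℓ where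
    []  : ∀ {s} → Chain _⟶_ 0 s s
    _∷_ : ∀ {k s t u} → s ⟶ t → Chain _⟶_ k t u → Chain _⟶_ (suc k) s u

  -- All chains from s have at most k steps, for some k: a chain which has not
  -- reached a normal form can be prolonged.

  Terminates : Rel Term 0ℓ → Pred Term 0ℓ
  Terminates _⟶_ s = ∃ λ k → ∀ {n t} → Chain _⟶_ n s t → n ≤ k

  Terminating : STRS → Set₁
  Terminating R = ∀ _⟶_ → IsReduction R _⟶_ → ∀ s → Ground s → Terminates _⟶_ s

  Strict : ∀ {A : Set} → Rel A 0ℓ → Rel A 0ℓ
  Strict _⪰_ s t = s ⪰ t × ¬ (t ⪰ s)

  NoInfiniteChain : ∀ {A : Set} → Rel A 0ℓ → Set
  NoInfiniteChain _≻_ = ¬ (∃ (InfiniteDescendingSequence (λ t s → s ≻ t)))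

  Monotonic : Rel ClassicalTerm 0ℓ → Set
  Monotonic _≻_ = ∀ b ts i {s t} → s ≻ t → app b (ts [ i ]≔ s) ≻ app b (ts [ i ]≔ t)

  ClosedUnderSubstitutions : Rel ClassicalTerm 0ℓ → Set
  ClosedUnderSubstitutions _≻_ =
    ∀ σ → IsClassicalSubstitution σ → ∀ {s t s′ t′} →
    ⌜ s ⌝ [ σ ]↦ ⌜ s′ ⌝ → ⌜ t ⌝ [ σ ]↦ ⌜ t′ ⌝ → s ≻ t → s′ ≻ t′

  record IsRewriteOrder (_≻_ : Rel ClassicalTerm 0ℓ) : Set where
    field
      monotonic                : Monotonic _≻_
      closedUnderSubstitutions : ClosedUnderSubstitutions _≻_

  data WorstPath (_⪰_ : Rel ClassicalTerm 0ℓ) : Rel Term 0ℓ where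
    classical : ∀ {s t} → s ⪰ t → WorstPath _⪰_ ⌜ s ⌝ ⌜ t ⌝
    some      : ∀ {s t n} {α : Fin (suc n) → Amplitude} {u : Fin (suc n) → ClassicalTerm} →
                s ≋ ∑ α (⌜_⌝ ∘ u) → Canonical α u →
                (∃ λ i → WorstPath _⪰_ ⌜ u i ⌝ t) → WorstPath _⪰_ s t
    all       : ∀ {s t n} {β : Fin (suc n) → Amplitude} {u : Fin (suc n) → ClassicalTerm} →
                t ≋ ∑ β (⌜_⌝ ∘ u) → Canonical β u →
                (∀ j → WorstPath _⪰_ s ⌜ u j ⌝) → WorstPath _⪰_ s t

  Compatible : STRS → Rel Term 0ℓ → Set
  Compatible R _≻_ = ∀ {l r} → STRS.Rules R l r → l ≻ r

{-# OPTIONS --safe #-}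

-- Fix natural numbers for the variables occurring in amplitudes and classical
-- terms for the others: every term then has a coefficient at each classical
-- term, and ≋ preserves coefficients. A reduction step acts on the support (the
-- classical terms with nonzero coefficient): each element of it is either kept,
-- being a normal form, or contracted by a rule. If l → r is a rule, l ≻_w r says
-- that l ≻ u for all u in the support of r, hence by the closure properties of ≻
-- a contracted element is ≻ all those that replace it. Contraction
-- is deterministic and supports are finite, so by well-founded induction every
-- classical term has a bound on the lengths of its contraction sequences; the
-- maximum of these bounds over the support of a term bounds its reductions.

module Submission where

open import Defs
open import Algebra.Bundles using (CommutativeSemiring)
open import Algebra.Structures.Biased using (IsCommutativeSemiringˡ)
open import Axiom.ExcludedMiddle using (ExcludedMiddle)
open import Data.Fin using (Fin; zero; suc)
import Data.Fin.Properties as Finₚ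
open import Data.List as List using (List; []; _∷_; _++_; cartesianProductWith)
open import Data.List.Membership.Propositional using (_∈_)
open import Data.List.Membership.Propositional.Properties using (∈-++⁺ˡ; ∈-++⁺ʳ; ∈-++⁻; ∈-map⁺; ∈-cartesianProductWith⁺)
open import Data.List.Properties using (++-conicalˡ; ++-conicalʳ)
open import Data.List.Relation.Unary.Any using (here; there)
open import Data.Nat using (ℕ; zero; suc; _≤_; z≤n; s≤s; _⊔_)
import Data.Nat.Properties as ℕₚ
open import Data.Product using (∃; Σ; _×_; _,_; proj₁; proj₂)
open import Data.Rational as ℚ using (0ℚ; 1ℚ; ½)
import Data.Rational.Properties as ℚₚ
open import Data.Rational.Solver using (module +-*-Solver)
open import Data.Sum using (_⊎_; inj₁; inj₂; [_,_]′)
open import Data.Vec using (Vec; []; _∷_; map; lookup; _[_]≔_)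
open import Data.Vec.Properties using ([]≔-lookup; []≔-idempotent; lookup∘update; lookup∘update′; ∷-injective)
open import Data.Vec.Relation.Binary.Pointwise.Inductive using (Pointwise; []; _∷_)
open import Data.Vec.Relation.Unary.All using (All; []; _∷_)
open import Data.Vec.Relation.Unary.All.Properties using (lookup⁺)
open import Function using (_∘_; Equivalence)
open import Induction.WellFounded using (Acc; acc; WellFounded)
open import Level using (0ℓ)
open import Relation.Binary using (Rel; IsEquivalence; IsPreorder; tri<; tri≈; tri>)
open import Relation.Binary.PropositionalEquality as ≡ using (_≡_; _≢_; cong; cong₂; subst)
open import Relation.Nullary using (¬_; Dec; yes; no; contradiction)
open import Relation.Nullary.Decidable using (decidable-stable)
open import Relation.Unary using (Pred)

-- Equality of real numbers is a congruence.

module RealProperties where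

  open Real
  open ℚₚ.≤-Reasoning
  open +-*-Solver

  -- Algebraic laws hold term by term in ℚ, so through this lemma they require no estimate.
  pointwise⇒≈ : ∀ x y → (∀ n → seq x n ≡ seq y n) → x ≈ y
  pointwise⇒≈ x y eq ε 0<ε = 0 , λ n _ →
    subst (ℚ._< ε)
      (cong ℚ.∣_∣ (≡.sym (subst (λ q → seq x n ℚ.- q ≡ 0ℚ) (eq n) (ℚₚ.+-inverseʳ (seq x n))))) 0<ε

  ≈-refl : ∀ x → x ≈ x
  ≈-refl x = pointwise⇒≈ x x (λ _ → ≡.refl)

  ≈-sym : ∀ x y → x ≈ y → y ≈ x
  ≈-sym x y x≈y ε 0<ε = let N , close = x≈y ε 0<ε in N , λ n N≤n → begin-strict
    ℚ.∣ seq y n ℚ.- seq x n ∣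
      ≡⟨ cong ℚ.∣_∣ (solve 2 (λ a b → b :- a := :- (a :- b)) ≡.refl (seq x n) (seq y n)) ⟩
    ℚ.∣ ℚ.- (seq x n ℚ.- seq y n) ∣ ≡⟨ ℚₚ.∣-p∣≡∣p∣ (seq x n ℚ.- seq y n) ⟩
    ℚ.∣ seq x n ℚ.- seq y n ∣       <⟨ close n N≤n ⟩
    ε                               ∎

  close-+ : ∀ p q {ε} → ℚ.∣ p ∣ ℚ.< ½ ℚ.* ε → ℚ.∣ q ∣ ℚ.< ½ ℚ.* ε → ℚ.∣ p ℚ.+ q ∣ ℚ.< ε
  close-+ p q {ε} p<ε/2 q<ε/2 = begin-strict
    ℚ.∣ p ℚ.+ q ∣           ≤⟨ ℚₚ.∣p+q∣≤∣p∣+∣q∣ p q ⟩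
    ℚ.∣ p ∣ ℚ.+ ℚ.∣ q ∣     <⟨ ℚₚ.+-mono-< p<ε/2 q<ε/2 ⟩
    ½ ℚ.* ε ℚ.+ ½ ℚ.* ε     ≡⟨ ½+½ ε ⟩
    ε                       ∎

  ≈-trans : ∀ x y z → x ≈ y → y ≈ z → x ≈ z
  ≈-trans x y z x≈y y≈z ε 0<ε =
    let N₁ , close₁ = x≈y (½ ℚ.* ε) (0<½* 0<ε)
        N₂ , close₂ = y≈z (½ ℚ.* ε) (0<½* 0<ε)
    in N₁ ⊔ N₂ , λ n N≤n → begin-strict
    ℚ.∣ seq x n ℚ.- seq z n ∣
      ≡⟨ cong ℚ.∣_∣ (solve 3 (λ a b c → a :- c := (a :- b) :+ (b :- c))
           ≡.refl (seq x n) (seq y n) (seq z n)) ⟩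
    ℚ.∣ (seq x n ℚ.- seq y n) ℚ.+ (seq y n ℚ.- seq z n) ∣
      <⟨ close-+ (seq x n ℚ.- seq y n) (seq y n ℚ.- seq z n)
           (close₁ n (ℕₚ.m⊔n≤o⇒m≤o N₁ N₂ N≤n)) (close₂ n (ℕₚ.m⊔n≤o⇒n≤o N₁ N₂ N≤n)) ⟩
    ε ∎

  +-cong : ∀ x x′ y y′ → x ≈ x′ → y ≈ y′ → x + y ≈ x′ + y′
  +-cong x x′ y y′ x≈x′ y≈y′ ε 0<ε =
    let N₁ , close₁ = x≈x′ (½ ℚ.* ε) (0<½* 0<ε)
        N₂ , close₂ = y≈y′ (½ ℚ.* ε) (0<½* 0<ε)
    in N₁ ⊔ N₂ , λ n N≤n → begin-strict
    ℚ.∣ (seq x n ℚ.+ seq y n) ℚ.- (seq x′ n ℚ.+ seq y′ n) ∣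
      ≡⟨ cong ℚ.∣_∣ (solve 4 (λ a b c d → (a :+ b) :- (c :+ d) := (a :- c) :+ (b :- d))
           ≡.refl (seq x n) (seq y n) (seq x′ n) (seq y′ n)) ⟩
    ℚ.∣ (seq x n ℚ.- seq x′ n) ℚ.+ (seq y n ℚ.- seq y′ n) ∣
      <⟨ close-+ (seq x n ℚ.- seq x′ n) (seq y n ℚ.- seq y′ n)
           (close₁ n (ℕₚ.m⊔n≤o⇒m≤o N₁ N₂ N≤n)) (close₂ n (ℕₚ.m⊔n≤o⇒n≤o N₁ N₂ N≤n)) ⟩
    ε ∎

  -‿cong : ∀ x y → x ≈ y → - x ≈ - y
  -‿cong x y x≈y ε 0<ε = let N , close = ≈-sym x y x≈y ε 0<ε in N , λ n N≤n → begin-strict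
    ℚ.∣ ℚ.- seq x n ℚ.- ℚ.- seq y n ∣
      ≡⟨ cong ℚ.∣_∣ (solve 2 (λ a b → :- a :- :- b := b :- a) ≡.refl (seq x n) (seq y n)) ⟩
    ℚ.∣ seq y n ℚ.- seq x n ∣
      <⟨ close n N≤n ⟩
    ε ∎

  -- A difference of products splits as a b - c d = a (b - d) + d (a - c). The factors a and d are
  -- eventually bounded, so it is enough that the differences be below ε/2 divided by these bounds,
  -- which are `η` and `θ`.
  *-cong : ∀ x x′ y y′ → x ≈ x′ → y ≈ y′ → x * y ≈ x′ * y′
  *-cong x x′ y y′ x≈x′ y≈y′ ε 0<ε =
    let B , M₁ , 0<B , x<B  = eventually-bounded x
        C , M₂ , 0<C , y′<C = eventually-bounded y′
        η , 0<η , Bη≡ε/2    = scale (½ ℚ.* ε) B (0<½* 0<ε) 0<B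
        θ , 0<θ , Cθ≡ε/2    = scale (½ ℚ.* ε) C (0<½* 0<ε) 0<C
        N₁ , y-close        = y≈y′ η 0<η
        N₂ , x-close        = x≈x′ θ 0<θ
        M = M₁ ⊔ M₂
        N = N₁ ⊔ N₂
    in M ⊔ N , λ n ≤n →
      let M≤n = ℕₚ.m⊔n≤o⇒m≤o M N ≤n
          N≤n = ℕₚ.m⊔n≤o⇒n≤o M N ≤n
          Δx  = seq x n ℚ.- seq x′ n
          Δy  = seq y n ℚ.- seq y′ n
      in begin-strict
      ℚ.∣ seq x n ℚ.* seq y n ℚ.- seq x′ n ℚ.* seq y′ n ∣
        ≡⟨ cong ℚ.∣_∣ (solve 4 (λ a b c d → a :* b :- c :* d := a :* (b :- d) :+ d :* (a :- c))
             ≡.refl (seq x n) (seq y n) (seq x′ n) (seq y′ n)) ⟩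
      ℚ.∣ seq x n ℚ.* Δy ℚ.+ seq y′ n ℚ.* Δx ∣
        <⟨ close-+ (seq x n ℚ.* Δy) (seq y′ n ℚ.* Δx)
             (small (seq x n) Δy 0<B (x<B n (ℕₚ.m⊔n≤o⇒m≤o M₁ M₂ M≤n))
               (y-close n (ℕₚ.m⊔n≤o⇒m≤o N₁ N₂ N≤n)) Bη≡ε/2)
             (small (seq y′ n) Δx 0<C (y′<C n (ℕₚ.m⊔n≤o⇒n≤o M₁ M₂ M≤n))
               (x-close n (ℕₚ.m⊔n≤o⇒n≤o N₁ N₂ N≤n)) Cθ≡ε/2) ⟩
      ε ∎
    where
    small : ∀ p q {B η δ} → 0ℚ ℚ.< B → ℚ.∣ p ∣ ℚ.< B → ℚ.∣ q ∣ ℚ.< η → B ℚ.* η ≡ δ →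
            ℚ.∣ p ℚ.* q ∣ ℚ.< δ
    small p q 0<B p<B q<η ≡.refl =
      ℚₚ.≤-<-trans (ℚₚ.≤-reflexive (ℚₚ.∣p*q∣≡∣p∣*∣q∣ p q)) (*-bound {p} {q} 0<B p<B q<η)

  1≉0 : ¬ (fromℚ 1ℚ ≈ fromℚ 0ℚ)
  1≉0 1≈0 with 1≈0 1ℚ (ℚₚ.positive⁻¹ 1ℚ)
  ... | N , close = ℚₚ.<-irrefl ≡.refl (close N ℕₚ.≤-refl)

-- The complex numbers form a commutative semiring.

module ComplexProperties where

  open Complex
  open Real using (seq)
  module ℝ = RealProperties
  open +-*-Solver

  infix 4 _≅_

  -- Unlike _≈_, which unfolds to a statement about sequences, this relation
  -- determines its arguments, which can then be inferred.

  record _≅_ (z w : ℂ) : Set where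
    constructor _+i_
    field
      re≈ : re z Real.≈ re w
      im≈ : im z Real.≈ im w

  pointwise⇒≅ : ∀ {z w} → (∀ n → seq (re z) n ≡ seq (re w) n) →
                (∀ n → seq (im z) n ≡ seq (im w) n) → z ≅ w
  pointwise⇒≅ {z} {w} eqʳ eqⁱ =
    ℝ.pointwise⇒≈ (re z) (re w) eqʳ +i ℝ.pointwise⇒≈ (im z) (im w) eqⁱ

  ≅-isEquivalence : IsEquivalence _≅_
  ≅-isEquivalence = record
    { refl  = λ {z} → ℝ.≈-refl (re z) +i ℝ.≈-refl (im z)
    ; sym   = λ {z} {w} (p +i q) → ℝ.≈-sym (re z) (re w) p +i ℝ.≈-sym (im z) (im w) q
    ; trans = λ {z} {w} {v} (p +i q) (p′ +i q′) →
        ℝ.≈-trans (re z) (re w) (re v) p p′ +i ℝ.≈-trans (im z) (im w) (im v) q q′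
    }

  +-cong : ∀ {z z′ w w′} → z ≅ z′ → w ≅ w′ → z + w ≅ z′ + w′
  +-cong {z} {z′} {w} {w′} (p +i q) (p′ +i q′) =
    ℝ.+-cong (re z) (re z′) (re w) (re w′) p p′ +i ℝ.+-cong (im z) (im z′) (im w) (im w′) q q′

  *-cong : ∀ {z z′ w w′} → z ≅ z′ → w ≅ w′ → z * w ≅ z′ * w′
  *-cong {z} {z′} {w} {w′} (p +i q) (p′ +i q′) =
    ℝ.+-cong (re z Real.* re w) (re z′ Real.* re w′)
             (Real.- (im z Real.* im w)) (Real.- (im z′ Real.* im w′))
      (ℝ.*-cong (re z) (re z′) (re w) (re w′) p p′)
      (ℝ.-‿cong (im z Real.* im w) (im z′ Real.* im w′)
        (ℝ.*-cong (im z) (im z′) (im w) (im w′) q q′)) +i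
    ℝ.+-cong (re z Real.* im w) (re z′ Real.* im w′) (im z Real.* re w) (im z′ Real.* re w′)
      (ℝ.*-cong (re z) (re z′) (im w) (im w′) p q′)
      (ℝ.*-cong (im z) (im z′) (re w) (re w′) q p′)

  +-assoc : ∀ z w v → (z + w) + v ≅ z + (w + v)
  +-assoc z w v = pointwise⇒≅
    (λ n → ℚₚ.+-assoc (seq (re z) n) (seq (re w) n) (seq (re v) n))
    (λ n → ℚₚ.+-assoc (seq (im z) n) (seq (im w) n) (seq (im v) n))

  +-comm : ∀ z w → z + w ≅ w + z
  +-comm z w = pointwise⇒≅
    (λ n → ℚₚ.+-comm (seq (re z) n) (seq (re w) n))
    (λ n → ℚₚ.+-comm (seq (im z) n) (seq (im w) n))

  +-identityˡ : ∀ z → 0ℂ + z ≅ z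
  +-identityˡ z = pointwise⇒≅
    (λ n → ℚₚ.+-identityˡ (seq (re z) n))
    (λ n → ℚₚ.+-identityˡ (seq (im z) n))

  *-assoc : ∀ z w v → (z * w) * v ≅ z * (w * v)
  *-assoc z w v = pointwise⇒≅
    (λ n → solve 6
      (λ a b c d e f → (a :* c :+ :- (b :* d)) :* e :+ :- ((a :* d :+ b :* c) :* f) :=
                       a :* (c :* e :+ :- (d :* f)) :+ :- (b :* (c :* f :+ d :* e))) ≡.refl
      (seq (re z) n) (seq (im z) n) (seq (re w) n) (seq (im w) n) (seq (re v) n) (seq (im v) n))
    (λ n → solve 6
      (λ a b c d e f → (a :* c :+ :- (b :* d)) :* f :+ (a :* d :+ b :* c) :* e :=
                       a :* (c :* f :+ d :* e) :+ b :* (c :* e :+ :- (d :* f))) ≡.refl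
      (seq (re z) n) (seq (im z) n) (seq (re w) n) (seq (im w) n) (seq (re v) n) (seq (im v) n))

  *-comm : ∀ z w → z * w ≅ w * z
  *-comm z w = pointwise⇒≅
    (λ n → solve 4
      (λ a b c d → a :* c :+ :- (b :* d) := c :* a :+ :- (d :* b)) ≡.refl
      (seq (re z) n) (seq (im z) n) (seq (re w) n) (seq (im w) n))
    (λ n → solve 4
      (λ a b c d → a :* d :+ b :* c := c :* b :+ d :* a) ≡.refl
      (seq (re z) n) (seq (im z) n) (seq (re w) n) (seq (im w) n))

  *-identityˡ : ∀ z → 1ℂ * z ≅ z
  *-identityˡ z = pointwise⇒≅
    (λ n → solve 2
      (λ a b → con 1ℚ :* a :+ :- (con 0ℚ :* b) := a) ≡.refl (seq (re z) n) (seq (im z) n))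
    (λ n → solve 2
      (λ a b → con 1ℚ :* b :+ con 0ℚ :* a := b) ≡.refl (seq (re z) n) (seq (im z) n))

  zeroˡ : ∀ z → 0ℂ * z ≅ 0ℂ
  zeroˡ z = pointwise⇒≅
    (λ n → solve 2
      (λ a b → con 0ℚ :* a :+ :- (con 0ℚ :* b) := con 0ℚ) ≡.refl (seq (re z) n) (seq (im z) n))
    (λ n → solve 2
      (λ a b → con 0ℚ :* b :+ con 0ℚ :* a := con 0ℚ) ≡.refl (seq (re z) n) (seq (im z) n))

  distribʳ : ∀ v z w → (z + w) * v ≅ z * v + w * v
  distribʳ v z w = pointwise⇒≅
    (λ n → solve 6
      (λ a b c d e f → (a :+ c) :* e :+ :- ((b :+ d) :* f) :=
                       (a :* e :+ :- (b :* f)) :+ (c :* e :+ :- (d :* f))) ≡.refl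
      (seq (re z) n) (seq (im z) n) (seq (re w) n) (seq (im w) n) (seq (re v) n) (seq (im v) n))
    (λ n → solve 6
      (λ a b c d e f → (a :+ c) :* f :+ (b :+ d) :* e :=
                       (a :* f :+ b :* e) :+ (c :* f :+ d :* e)) ≡.refl
      (seq (re z) n) (seq (im z) n) (seq (re w) n) (seq (im w) n) (seq (re v) n) (seq (im v) n))

  commutativeSemiring : CommutativeSemiring 0ℓ 0ℓ
  commutativeSemiring = record
    { Carrier = ℂ ; _≈_ = _≅_ ; _+_ = _+_ ; _*_ = _*_ ; 0# = 0ℂ ; 1# = 1ℂ
    ; isCommutativeSemiring = IsCommutativeSemiringˡ.isCommutativeSemiring record
      { +-isCommutativeMonoid = isCommutativeMonoid {_+_} {0ℂ} +-cong +-assoc +-identityˡ +-comm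
      ; *-isCommutativeMonoid = isCommutativeMonoid {_*_} {1ℂ} *-cong *-assoc *-identityˡ *-comm
      ; distribʳ = distribʳ
      ; zeroˡ    = zeroˡ
      } }
    where
    open import Algebra.Structures _≅_ using (IsCommutativeMonoid)
    open import Algebra.Definitions _≅_ using (Congruent₂; Associative; LeftIdentity; Commutative)
    open IsEquivalence ≅-isEquivalence using (trans)
    isCommutativeMonoid : ∀ {_∙_ ε} → Congruent₂ _∙_ → Associative _∙_ → LeftIdentity ε _∙_ →
                          Commutative _∙_ → IsCommutativeMonoid _∙_ ε
    isCommutativeMonoid {_∙_} {ε} cong assoc identityˡ comm = record
      { isMonoid = record
        { isSemigroup = record
          { isMagma = record { isEquivalence = ≅-isEquivalence ; ∙-cong = cong }
          ; assoc = assoc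
          }
        ; identity = identityˡ , λ z → trans (comm z ε) (identityˡ z)
        }
      ; comm = comm
      }

-- Amplitudes are evaluated in an abstract semiring, so that their values do not
-- unfold to Cauchy sequences.

record Evaluation (Sig : Signature) : Set₁ where

  open Syntax Sig using (Amplitude; _·_; _⊕_; ⟦_⟧)

  field
    commutativeSemiring : CommutativeSemiring 0ℓ 0ℓ

  open CommutativeSemiring commutativeSemiring public

  field
    eval   : Amplitude → Carrier
    eval-· : ∀ α β → eval (α · β) ≈ eval α * eval β
    eval-⊕ : ∀ α β → eval (α ⊕ β) ≈ eval α + eval β
    eval-0 : ∀ α → ⟦ α ⟧ Complex.≈ Complex.0ℂ → eval α ≈ 0#
    eval-1 : ∀ α → ⟦ α ⟧ Complex.≈ Complex.1ℂ → eval α ≈ 1#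
    0-eval : ∀ α → eval α ≈ 0# → ⟦ α ⟧ Complex.≈ Complex.0ℂ
    1≉0    : ¬ (1# ≈ 0#)

complexEvaluation : ∀ Sig → Evaluation Sig
complexEvaluation Sig = record
  { commutativeSemiring = ComplexProperties.commutativeSemiring
  ; eval   = ⟦_⟧
  ; eval-· = λ α β → refl {⟦ α · β ⟧}
  ; eval-⊕ = λ α β → refl {⟦ α ⊕ β ⟧}
  ; eval-0 = λ _ (p , q) → p +i q
  ; eval-1 = λ _ (p , q) → p +i q
  ; 0-eval = λ _ p → _≅_.re≈ p , _≅_.im≈ p
  ; 1≉0    = λ 1≅0 → RealProperties.1≉0 (_≅_.re≈ 1≅0)
  }
  where
  open Syntax Sig using (_·_; _⊕_; ⟦_⟧)
  open ComplexProperties using (_≅_; _+i_; ≅-isEquivalence)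
  open IsEquivalence ≅-isEquivalence using (refl)

-- Injectivity, substitution and evaluation contexts.

module SyntaxProperties (Sig : Signature) where

  open Syntax Sig

  ⌊⌋-injective : ∀ ι κ → ⌊ ι ⌋ ≡ ⌊ κ ⌋ → ι ≡ κ
  ⌊⌋-injective (var x) (var .x) ≡.refl = ≡.refl
  ⌊⌋-injective zero    zero     _      = ≡.refl
  ⌊⌋-injective (suc ι) (suc κ)  eq     = cong suc (⌊⌋-injective ι κ (arg eq))
    where
    arg : ∀ {s t} → Term.app (inj₁ 𝐒) (s ∷ []) ≡ app (inj₁ 𝐒) (t ∷ []) → s ≡ t
    arg ≡.refl = ≡.refl

  -- Stated for variable vectors, so that matching on `refl` succeeds; it is applied to calls of
  -- `⌜_⌝*` and `_[_]≔_`, on which unification would be stuck.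
  app≡app : ∀ {b b′ ts ts′} → Term.app b ts ≡ app b′ ts′ →
            Σ (b ≡ b′) λ b≡b′ → subst (Vec Term ∘ ar) b≡b′ ts ≡ ts′
  app≡app ≡.refl = ≡.refl , ≡.refl

  ⌜⌝-injective  : ∀ c d → ⌜ c ⌝ ≡ ⌜ d ⌝ → c ≡ d
  ⌜⌝*-injective : ∀ {n} (cs ds : Vec ClassicalTerm n) → ⌜ cs ⌝* ≡ ⌜ ds ⌝* → cs ≡ ds
  ⌜⌝-injective (var x)    (var .x)   ≡.refl = ≡.refl
  ⌜⌝-injective (app b cs) (app b′ ds) eq with app≡app eq
  ... | ≡.refl , eq′ = cong (app b) (⌜⌝*-injective cs ds eq′)
  ⌜⌝*-injective []       []       _  = ≡.refl
  ⌜⌝*-injective (c ∷ cs) (d ∷ ds) eq =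
    let c≡d , cs≡ds = ∷-injective eq in cong₂ _∷_ (⌜⌝-injective c d c≡d) (⌜⌝*-injective cs ds cs≡ds)

  ∈-++-case : ∀ xs {ys} {P : Variable → Set} → (∀ {x} → x ∈ xs → P x) → (∀ {x} → x ∈ ys → P x) →
              ∀ {x} → x ∈ xs ++ ys → P x
  ∈-++-case xs p q x∈ = [ p , q ]′ (∈-++⁻ xs x∈)

  -- How a term and its instance determine the substitution, and conversely.

  module _ {σ τ : Assignment} where

    ↦ᴺ-agree : ∀ {ι κ} → ι [ σ ]↦ᴺ κ → ι [ τ ]↦ᴺ κ → ∀ {x} → x ∈ varsᴺ ι → σ x ≡ τ x
    ↦ᴺ-agree (var p) (var q) (here ≡.refl) = ≡.trans p (≡.sym q)
    ↦ᴺ-agree (suc p) (suc q) x∈            = ↦ᴺ-agree p q x∈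

    ↦ᴺ*-agree : ∀ {n} {ιs κs : Vec Natural n} → Pointwise (_[ σ ]↦ᴺ_) ιs κs →
                Pointwise (_[ τ ]↦ᴺ_) ιs κs → ∀ {x} → x ∈ varsᴺ* ιs → σ x ≡ τ x
    ↦ᴺ*-agree (_∷_ {x = ι} p ps) (q ∷ qs) =
      ∈-++-case (varsᴺ ι) (↦ᴺ-agree p q) (↦ᴺ*-agree ps qs)

    ↦ᴬ-agree : ∀ {α β} → α [ σ ]↦ᴬ β → α [ τ ]↦ᴬ β → ∀ {x} → x ∈ varsᴬ α → σ x ≡ τ x
    ↦ᴬ-agree (amp ps) (amp qs) = ↦ᴺ*-agree ps qs
    ↦ᴬ-agree (_·_ {α = α} p p′) (q · q′) =
      ∈-++-case (varsᴬ α) (↦ᴬ-agree p q) (↦ᴬ-agree p′ q′)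
    ↦ᴬ-agree (_⊕_ {α = α} p p′) (q ⊕ q′) =
      ∈-++-case (varsᴬ α) (↦ᴬ-agree p q) (↦ᴬ-agree p′ q′)

    -- Substitution is structural, so an instance records the value of each variable of `t`. The
    -- equation between the instances is kept apart because at a variable they are calls of `σ` and
    -- `τ`.
    ↦-agree  : ∀ {t w w′} → t [ σ ]↦ w → t [ τ ]↦ w′ → w ≡ w′ → ∀ {x} → x ∈ vars t → σ x ≡ τ x
    ↦*-agree : ∀ {n} {ts ws ws′ : Vec Term n} → Pointwise (_[ σ ]↦_) ts ws →
               Pointwise (_[ τ ]↦_) ts ws′ → ws ≡ ws′ → ∀ {x} → x ∈ vars* ts → σ x ≡ τ x
    ↦-agree var var eq (here ≡.refl) = eq
    ↦-agree (app ps) (app qs) ≡.refl = ↦*-agree ps qs ≡.refl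
    ↦-agree (_·_ {α = α} p p′) (q · q′) ≡.refl =
      ∈-++-case (varsᴬ α) (↦ᴬ-agree p q) (↦-agree p′ q′ ≡.refl)
    ↦-agree (_⊕_ {s = s} p p′) (q ⊕ q′) ≡.refl =
      ∈-++-case (vars s) (↦-agree p q ≡.refl) (↦-agree p′ q′ ≡.refl)
    ↦*-agree (_∷_ {x = t} p ps) (q ∷ qs) ≡.refl =
      ∈-++-case (vars t) (↦-agree p q ≡.refl) (↦*-agree ps qs ≡.refl)

    ↦ᴺ-unique : ∀ {ι κ κ′} → ι [ σ ]↦ᴺ κ → ι [ τ ]↦ᴺ κ′ → (∀ {x} → x ∈ varsᴺ ι → σ x ≡ τ x) →
                κ ≡ κ′
    ↦ᴺ-unique (var p) (var q) σ≡τ =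
      ⌊⌋-injective _ _ (≡.trans (≡.sym p) (≡.trans (σ≡τ (here ≡.refl)) q))
    ↦ᴺ-unique zero    zero    σ≡τ = ≡.refl
    ↦ᴺ-unique (suc p) (suc q) σ≡τ = cong suc (↦ᴺ-unique p q σ≡τ)

    ↦ᴺ*-unique : ∀ {n} {ιs κs κs′ : Vec Natural n} → Pointwise (_[ σ ]↦ᴺ_) ιs κs →
                 Pointwise (_[ τ ]↦ᴺ_) ιs κs′ → (∀ {x} → x ∈ varsᴺ* ιs → σ x ≡ τ x) → κs ≡ κs′
    ↦ᴺ*-unique []                  []       σ≡τ = ≡.refl
    ↦ᴺ*-unique (_∷_ {x = ι} p ps) (q ∷ qs) σ≡τ =
      cong₂ _∷_ (↦ᴺ-unique p q (σ≡τ ∘ ∈-++⁺ˡ)) (↦ᴺ*-unique ps qs (σ≡τ ∘ ∈-++⁺ʳ (varsᴺ ι)))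

    ↦ᴬ-unique : ∀ {α β β′} → α [ σ ]↦ᴬ β → α [ τ ]↦ᴬ β′ → (∀ {x} → x ∈ varsᴬ α → σ x ≡ τ x) →
                β ≡ β′
    ↦ᴬ-unique (amp ps) (amp qs) σ≡τ = cong (amp _) (↦ᴺ*-unique ps qs σ≡τ)
    ↦ᴬ-unique (_·_ {α = α} p p′) (q · q′) σ≡τ =
      cong₂ _·_ (↦ᴬ-unique p q (σ≡τ ∘ ∈-++⁺ˡ)) (↦ᴬ-unique p′ q′ (σ≡τ ∘ ∈-++⁺ʳ (varsᴬ α)))
    ↦ᴬ-unique (_⊕_ {α = α} p p′) (q ⊕ q′) σ≡τ =
      cong₂ _⊕_ (↦ᴬ-unique p q (σ≡τ ∘ ∈-++⁺ˡ)) (↦ᴬ-unique p′ q′ (σ≡τ ∘ ∈-++⁺ʳ (varsᴬ α)))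

    ↦-unique  : ∀ {t w w′} → t [ σ ]↦ w → t [ τ ]↦ w′ → (∀ {x} → x ∈ vars t → σ x ≡ τ x) → w ≡ w′
    ↦*-unique : ∀ {n} {ts ws ws′ : Vec Term n} → Pointwise (_[ σ ]↦_) ts ws →
                Pointwise (_[ τ ]↦_) ts ws′ → (∀ {x} → x ∈ vars* ts → σ x ≡ τ x) → ws ≡ ws′
    ↦-unique var      var      σ≡τ = σ≡τ (here ≡.refl)
    ↦-unique (app ps) (app qs) σ≡τ = cong (app _) (↦*-unique ps qs σ≡τ)
    ↦-unique (_·_ {α = α} p p′) (q · q′) σ≡τ =
      cong₂ _·_ (↦ᴬ-unique p q (σ≡τ ∘ ∈-++⁺ˡ)) (↦-unique p′ q′ (σ≡τ ∘ ∈-++⁺ʳ (varsᴬ α)))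
    ↦-unique (_⊕_ {s = s} p p′) (q ⊕ q′) σ≡τ =
      cong₂ _⊕_ (↦-unique p q (σ≡τ ∘ ∈-++⁺ˡ)) (↦-unique p′ q′ (σ≡τ ∘ ∈-++⁺ʳ (vars s)))
    ↦*-unique []                 []       σ≡τ = ≡.refl
    ↦*-unique (_∷_ {x = t} p ps) (q ∷ qs) σ≡τ =
      cong₂ _∷_ (↦-unique p q (σ≡τ ∘ ∈-++⁺ˡ)) (↦*-unique ps qs (σ≡τ ∘ ∈-++⁺ʳ (vars t)))

  -- The value of a variable of `t` occurs as a subterm of the instance; a `t` with `_·_` or `_⊕_`
  -- on the way to it has no classical instance.
  ↦-classical  : ∀ {σ t w} e → t [ σ ]↦ w → w ≡ ⌜ e ⌝ → ∀ {x} → x ∈ vars t → Classical (σ x)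
  ↦*-classical : ∀ {σ n} {ts ws : Vec Term n} es → Pointwise (_[ σ ]↦_) ts ws → ws ≡ ⌜ es ⌝* →
                 ∀ {x} → x ∈ vars* ts → Classical (σ x)
  ↦-classical e          var      eq (here ≡.refl) = e , eq
  ↦-classical (app b es) (app ps) eq x∈ with app≡app eq
  ... | ≡.refl , eq′ = ↦*-classical es ps eq′ x∈
  ↦-classical (var _)   (_ · _)  ()
  ↦-classical (app _ _) (_ · _)  ()
  ↦-classical (var _)   (_ ⊕ _)  ()
  ↦-classical (app _ _) (_ ⊕ _)  ()
  ↦*-classical (e ∷ es) (_∷_ {x = t} p ps) eq =
    let eq₁ , eq₂ = ∷-injective eq
    in ∈-++-case (vars t) (↦-classical e p eq₁) (↦*-classical es ps eq₂)

  pattern-classical  : ∀ {p} → Pattern p → Classical p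
  pattern-classical* : ∀ {n} {ps : Vec Term n} → All Pattern ps → ∃ λ cs → ps ≡ ⌜ cs ⌝*
  pattern-classical (var x)    = var x , ≡.refl
  pattern-classical (con c ps) =
    let cs , eq = pattern-classical* ps in app (inj₁ c) cs , cong (app (inj₁ c)) eq
  pattern-classical* []       = [] , ≡.refl
  pattern-classical* (p ∷ ps) =
    let c , eq = pattern-classical p ; cs , eq* = pattern-classical* ps in c ∷ cs , cong₂ _∷_ eq eq*

  pattern-value  : ∀ {σ p w} → IsSubstitution σ → Pattern p → p [ σ ]↦ w → Value w
  pattern-value* : ∀ {σ n} {ps ws : Vec Term n} → IsSubstitution σ → All Pattern ps →
                   Pointwise (_[ σ ]↦_) ps ws → All Value ws
  pattern-value σ-value (var x)    var      = σ-value x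
  pattern-value σ-value (con c ps) (app ws) = con c (pattern-value* σ-value ps ws)
  pattern-value* σ-value []       []       = []
  pattern-value* σ-value (p ∷ ps) (w ∷ ws) = pattern-value σ-value p w ∷ pattern-value* σ-value ps ws

  -- Unique decomposition of a term into evaluation context and redex.

  data Call : Term → Set where
    call : ∀ f {vs} → All Value vs → Call (app (inj₂ f) vs)

  -- In a value, every subterm reached through applications is again a value, whereas the one in the
  -- hole begins with a function symbol.
  plug-call-not-value : ∀ E {l} → Call l → ¬ Value (plug E l)
  plug-call-not-value ◇ (call f vs) ()
  plug-call-not-value (app b ts i _ E) {l} l-call (con c vs) = plug-call-not-value E l-call
    (subst Value (lookup∘update i ts (plug E l)) (lookup⁺ vs i))

  -- At each level the hole is in the leftmost argument that is not a value, and a call, whose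
  -- arguments are all values, leaves no room for a deeper hole.
  plug-unique : ∀ E₁ E₂ {l₁ l₂} → Call l₁ → Call l₂ → plug E₁ l₁ ≡ plug E₂ l₂ →
                l₁ ≡ l₂ × (∀ t → plug E₁ t ≡ plug E₂ t)
  plug-unique ◇ ◇ _ _ eq = eq , λ _ → ≡.refl
  plug-unique ◇ (app b ts i _ E) {l₂ = l₂} (call f vs) l₂-call eq with app≡app eq
  ... | ≡.refl , ≡.refl = contradiction
    (subst Value (lookup∘update i ts (plug E l₂)) (lookup⁺ vs i)) (plug-call-not-value E l₂-call)
  plug-unique (app b ts i _ E) ◇ {l₁ = l₁} l₁-call (call f vs) eq with app≡app (≡.sym eq)
  ... | ≡.refl , ≡.refl = contradiction
    (subst Value (lookup∘update i ts (plug E l₁)) (lookup⁺ vs i)) (plug-call-not-value E l₁-call)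
  plug-unique (app b ts i vs E₁) (app b′ us j ws E₂) {l₁} {l₂} l₁-call l₂-call eq with app≡app eq
  ... | ≡.refl , eq′ with Finₚ.<-cmp i j
  -- The hole of the second context is further right, so `ws` makes a value of argument `i`, which
  -- contains `l₁`.
  ...   | tri< i<j i≢j _ = contradiction
    (subst Value
      (≡.trans (≡.sym (lookup∘update′ i≢j us (plug E₂ l₂)))
        (≡.trans (cong (λ ts′ → lookup ts′ i) (≡.sym eq′)) (lookup∘update i ts (plug E₁ l₁))))
      (ws i i<j))
    (plug-call-not-value E₁ l₁-call)
  ...   | tri> _ i≢j j<i = contradiction
    (subst Value
      (≡.trans (≡.sym (lookup∘update′ (i≢j ∘ ≡.sym) ts (plug E₁ l₁)))
        (≡.trans (cong (λ ts′ → lookup ts′ j) eq′) (lookup∘update j us (plug E₂ l₂))))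
      (vs j j<i))
    (plug-call-not-value E₂ l₂-call)
  ...   | tri≈ _ ≡.refl _ =
    let l₁≡l₂ , plug≡ = plug-unique E₁ E₂ l₁-call l₂-call
          (≡.trans (≡.sym (lookup∘update i ts (plug E₁ l₁)))
            (≡.trans (cong (λ ts′ → lookup ts′ i) eq′) (lookup∘update i us (plug E₂ l₂))))
    -- `ts` and `us` may differ at the hole, so they are compared only after their entries there are
    -- overwritten.
    in l₁≡l₂ , λ t → cong (app b) (begin
      ts [ i ]≔ plug E₁ t                         ≡⟨ []≔-idempotent ts i ⟨
      (ts [ i ]≔ plug E₁ l₁) [ i ]≔ plug E₁ t     ≡⟨ cong₂ _[ i ]≔_ eq′ (plug≡ t) ⟩
      (us [ i ]≔ plug E₂ l₂) [ i ]≔ plug E₂ t     ≡⟨ []≔-idempotent us i ⟩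
      us [ i ]≔ plug E₂ t                         ∎)
    where open ≡.≡-Reasoning

-- Coefficients of terms at classical terms.

module Coefficients (em : ExcludedMiddle 0ℓ) (Sig : Signature) (K : Evaluation Sig) where

  open Syntax Sig
  open Evaluation K hiding (zero)
  open import Algebra.Properties.CommutativeSemigroup *-commutativeSemigroup using (x∙yz≈y∙xz)

  numeral : ℕ → Natural
  numeral zero    = zero
  numeral (suc n) = suc (numeral n)

  instᴺ : (Variable → ℕ) → Natural → Natural
  instᴺ ν (var x) = numeral (ν x)
  instᴺ ν zero    = zero
  instᴺ ν (suc ι) = suc (instᴺ ν ι)

  instᴬ : (Variable → ℕ) → Amplitude → Amplitude
  instᴬ ν (amp a ιs) = amp a (map (instᴺ ν) ιs)
  instᴬ ν (α · β)    = instᴬ ν α · instᴬ ν β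
  instᴬ ν (α ⊕ β)    = instᴬ ν α ⊕ instᴬ ν β

  numeral-value : ∀ n → Value ⌊ numeral n ⌋
  numeral-value zero    = con 𝟎 []
  numeral-value (suc n) = con 𝐒 (numeral-value n ∷ [])

  varsᴺ-numeral : ∀ n → varsᴺ (numeral n) ≡ []
  varsᴺ-numeral zero    = ≡.refl
  varsᴺ-numeral (suc n) = varsᴺ-numeral n

  instᴺ-ground : ∀ ν ι → varsᴺ (instᴺ ν ι) ≡ []
  instᴺ-ground ν (var x) = varsᴺ-numeral (ν x)
  instᴺ-ground ν zero    = ≡.refl
  instᴺ-ground ν (suc ι) = instᴺ-ground ν ι

  instᴺ*-ground : ∀ ν {n} (ιs : Vec Natural n) → varsᴺ* (map (instᴺ ν) ιs) ≡ []
  instᴺ*-ground ν []       = ≡.refl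
  instᴺ*-ground ν (ι ∷ ιs) = cong₂ _++_ (instᴺ-ground ν ι) (instᴺ*-ground ν ιs)

  instᴬ-ground : ∀ ν α → GroundAmplitude (instᴬ ν α)
  instᴬ-ground ν (amp a ιs) = instᴺ*-ground ν ιs
  instᴬ-ground ν (α · β)    = cong₂ _++_ (instᴬ-ground ν α) (instᴬ-ground ν β)
  instᴬ-ground ν (α ⊕ β)    = cong₂ _++_ (instᴬ-ground ν α) (instᴬ-ground ν β)

  instᴺ-↦ : ∀ ν ι → ι [ ⌊_⌋ ∘ numeral ∘ ν ]↦ᴺ instᴺ ν ι
  instᴺ-↦ ν (var x) = var ≡.refl
  instᴺ-↦ ν zero    = zero
  instᴺ-↦ ν (suc ι) = suc (instᴺ-↦ ν ι)

  instᴺ*-↦ : ∀ ν {n} (ιs : Vec Natural n) →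
             Pointwise (_[ ⌊_⌋ ∘ numeral ∘ ν ]↦ᴺ_) ιs (map (instᴺ ν) ιs)
  instᴺ*-↦ ν []       = []
  instᴺ*-↦ ν (ι ∷ ιs) = instᴺ-↦ ν ι ∷ instᴺ*-↦ ν ιs

  instᴬ-↦ : ∀ ν α → α [ ⌊_⌋ ∘ numeral ∘ ν ]↦ᴬ instᴬ ν α
  instᴬ-↦ ν (amp a ιs) = amp (instᴺ*-↦ ν ιs)
  instᴬ-↦ ν (α · β)    = instᴬ-↦ ν α · instᴬ-↦ ν β
  instᴬ-↦ ν (α ⊕ β)    = instᴬ-↦ ν α ⊕ instᴬ-↦ ν β

  -- Numerals are values and make `α` ground, so this instance is among those over which `⟦_⟧≐_`
  -- quantifies.
  ⟦instᴬ⟧ : ∀ ν α z → ⟦ α ⟧≐ z → ⟦ instᴬ ν α ⟧ Complex.≈ z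
  ⟦instᴬ⟧ ν α z α≐z =
    α≐z (⌊_⌋ ∘ numeral ∘ ν) (numeral-value ∘ ν) (instᴬ ν α) (instᴬ-↦ ν α) (instᴬ-ground ν α)

  indicator : {P : Set} → Dec P → Carrier
  indicator (yes _) = 1#
  indicator (no _)  = 0#

  -- A positive decision of this predicate yields the arguments at length `ar b`, with no transport
  -- along an equality of symbols.
  data HasHead (b : Symbol) : ClassicalTerm → Set where
    head : ∀ cs → HasHead b (app b cs)

  onHead : ∀ {b c} → (Vec ClassicalTerm (ar b) → Carrier) → Dec (HasHead b c) → Carrier
  onHead g (yes (head cs)) = g cs
  onHead g (no _)          = 0#

  sub  : (Variable → ClassicalTerm) → ClassicalTerm → ClassicalTerm
  sub* : (Variable → ClassicalTerm) → ∀ {n} → Vec ClassicalTerm n → Vec ClassicalTerm n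
  sub τ (var x)    = τ x
  sub τ (app b us) = app b (sub* τ us)
  sub* τ []        = []
  sub* τ (u ∷ us)  = sub τ u ∷ sub* τ us

  sub-var  : ∀ u → sub var u ≡ u
  sub*-var : ∀ {n} (us : Vec ClassicalTerm n) → sub* var us ≡ us
  sub-var (var x)    = ≡.refl
  sub-var (app b us) = cong (app b) (sub*-var us)
  sub*-var []        = ≡.refl
  sub*-var (u ∷ us)  = cong₂ _∷_ (sub-var u) (sub*-var us)

  onHead-app : ∀ {b} g cs (d : Dec (HasHead b (app b cs))) → onHead g d ≈ g cs
  onHead-app g cs (yes (head .cs)) = refl
  onHead-app g cs (no ¬h)          = contradiction (head cs) ¬h

  onHead-cong : ∀ {b c g h} (d : Dec (HasHead b c)) → (∀ cs → g cs ≈ h cs) →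
                onHead g d ≈ onHead h d
  onHead-cong (yes (head cs)) eq = eq cs
  onHead-cong (no _)          eq = refl

  onHead-* : ∀ {b c g h} a (d : Dec (HasHead b c)) → (∀ cs → g cs ≈ a * h cs) →
             onHead g d ≈ a * onHead h d
  onHead-* a (yes (head cs)) eq = eq cs
  onHead-* a (no _)          eq = sym (zeroʳ a)

  onHead-+ : ∀ {b c g h k} (d : Dec (HasHead b c)) → (∀ cs → g cs ≈ h cs + k cs) →
             onHead g d ≈ onHead h d + onHead k d
  onHead-+ (yes (head cs)) eq = eq cs
  onHead-+ (no _)          eq = sym (+-identityˡ 0#)

  -- coeff t c is the coefficient of c in t, after instantiating the variables by
  -- ν in amplitudes and by τ elsewhere. Separating the two makes it total.

  module _ (ν : Variable → ℕ) (τ : Variable → ClassicalTerm) where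

    coeff  : Term → ClassicalTerm → Carrier
    coeff* : ∀ {n} → Vec Term n → Vec ClassicalTerm n → Carrier
    coeff (var x)    c = indicator (em {P = τ x ≡ c})
    coeff (app b ts) c = onHead (coeff* ts) (em {P = HasHead b c})
    coeff (α · t)    c = eval (instᴬ ν α) * coeff t c
    coeff (s ⊕ t)    c = coeff s c + coeff t c
    coeff* []       []       = 1#
    coeff* (t ∷ ts) (c ∷ cs) = coeff t c * coeff* ts cs

    coeff*-cong : ∀ {n} (ts : Vec Term n) i {s t} → (∀ c → coeff s c ≈ coeff t c) →
                  ∀ cs → coeff* (ts [ i ]≔ s) cs ≈ coeff* (ts [ i ]≔ t) cs
    coeff*-cong (_ ∷ ts) zero    eq (c ∷ cs) = *-congʳ (eq c)
    coeff*-cong (_ ∷ ts) (suc i) eq (c ∷ cs) = *-congˡ (coeff*-cong ts i eq cs)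

    coeff*-· : ∀ {n} (ts : Vec Term n) i α t cs →
               coeff* (ts [ i ]≔ (α · t)) cs ≈ eval (instᴬ ν α) * coeff* (ts [ i ]≔ t) cs
    coeff*-· (_ ∷ ts) zero    α t (c ∷ cs) = *-assoc _ _ _
    coeff*-· (_ ∷ ts) (suc i) α t (c ∷ cs) =
      trans (*-congˡ (coeff*-· ts i α t cs)) (x∙yz≈y∙xz _ _ _)

    coeff*-⊕ : ∀ {n} (ts : Vec Term n) i s t cs →
               coeff* (ts [ i ]≔ (s ⊕ t)) cs ≈ coeff* (ts [ i ]≔ s) cs + coeff* (ts [ i ]≔ t) cs
    coeff*-⊕ (_ ∷ ts) zero    s t (c ∷ cs) = distribʳ _ _ _
    coeff*-⊕ (_ ∷ ts) (suc i) s t (c ∷ cs) =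
      trans (*-congˡ (coeff*-⊕ ts i s t cs)) (distribˡ _ _ _)

    -- Each axiom becomes a semiring law. Symbols are linear in each argument because `coeff*` is a
    -- product with one factor per argument.
    coeff-≋ : ∀ {s t} → s ≋ t → ∀ c → coeff s c ≈ coeff t c
    coeff-≋ ≋-refl                 c = refl
    coeff-≋ (≋-sym s≋t)            c = sym (coeff-≋ s≋t c)
    coeff-≋ (≋-trans s≋t t≋u)      c = trans (coeff-≋ s≋t c) (coeff-≋ t≋u c)
    coeff-≋ (app-cong b ts i s≋t)  c = onHead-cong em (coeff*-cong ts i (coeff-≋ s≋t))
    coeff-≋ (·-cong α s≋t)         c = *-congˡ (coeff-≋ s≋t c)
    coeff-≋ (⊕-congˡ u s≋t)        c = +-congˡ (coeff-≋ s≋t c)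
    coeff-≋ (⊕-congʳ u s≋t)        c = +-congʳ (coeff-≋ s≋t c)
    coeff-≋ (⊕-comm t₁ t₂)         c = +-comm _ _
    coeff-≋ (⊕-assoc t₁ t₂ t₃)     c = sym (+-assoc _ _ _)
    coeff-≋ (·-zero s α t α≐0)     c =
      trans (+-congˡ (trans (*-congʳ (eval-0 _ (⟦instᴬ⟧ ν α Complex.0ℂ α≐0))) (zeroˡ _))) (+-identityʳ _)
    coeff-≋ (·-one α t α≐1)        c =
      trans (*-congʳ (eval-1 _ (⟦instᴬ⟧ ν α Complex.1ℂ α≐1))) (*-identityˡ _)
    coeff-≋ (·-assoc α β t)        c =
      trans (sym (*-assoc _ _ _)) (*-congʳ (sym (eval-· _ _)))
    coeff-≋ (·-distˡ α t₁ t₂)      c = distribˡ _ _ _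
    coeff-≋ (·-distʳ α β t)        c =
      trans (sym (distribʳ _ _ _)) (*-congʳ (sym (eval-⊕ _ _)))
    coeff-≋ (app-· b ts i α t)     c = onHead-* _ em (coeff*-· ts i α t)
    coeff-≋ (app-⊕ b ts i t₁ t₂)   c = onHead-+ em (coeff*-⊕ ts i t₁ t₂)

    -- Together with `coeff-⌜⌝-off`, this makes a classical term a basis vector, located at its
    -- instance by `τ`.
    coeff-⌜⌝-diag  : ∀ u → coeff ⌜ u ⌝ (sub τ u) ≈ 1#
    coeff*-⌜⌝-diag : ∀ {n} (us : Vec ClassicalTerm n) → coeff* ⌜ us ⌝* (sub* τ us) ≈ 1#
    coeff-⌜⌝-diag (var x) with em {P = τ x ≡ τ x}
    ... | yes _  = refl
    ... | no x≢x = contradiction ≡.refl x≢x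
    coeff-⌜⌝-diag (app b us) =
      trans (onHead-app (coeff* ⌜ us ⌝*) (sub* τ us) em) (coeff*-⌜⌝-diag us)
    coeff*-⌜⌝-diag []       = refl
    coeff*-⌜⌝-diag (u ∷ us) =
      trans (*-cong (coeff-⌜⌝-diag u) (coeff*-⌜⌝-diag us)) (*-identityˡ 1#)

    coeff-⌜⌝-off  : ∀ u {c} → sub τ u ≢ c → coeff ⌜ u ⌝ c ≈ 0#
    coeff*-⌜⌝-off : ∀ {n} (us : Vec ClassicalTerm n) {cs} → sub* τ us ≢ cs →
                    coeff* ⌜ us ⌝* cs ≈ 0#
    coeff-⌜⌝-off (var x) {c} τx≢c with em {P = τ x ≡ c}
    ... | yes τx≡c = contradiction τx≡c τx≢c
    ... | no _     = refl
    coeff-⌜⌝-off (app b us) {c} ≢c with em {P = HasHead b c}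
    ... | yes (head cs) = coeff*-⌜⌝-off us (≢c ∘ cong (app b))
    ... | no _          = refl
    coeff*-⌜⌝-off []       {[]}     ≢cs = contradiction ≡.refl ≢cs
    coeff*-⌜⌝-off (u ∷ us) {c ∷ cs} ≢cs with em {P = sub τ u ≡ c}
    ... | yes ≡.refl = trans (*-congˡ (coeff*-⌜⌝-off us (≢cs ∘ cong (_ ∷_)))) (zeroʳ _)
    ... | no ≢c      = trans (*-congʳ (coeff-⌜⌝-off u ≢c)) (zeroˡ _)

    -- Supports and their finiteness.

    Supp : Term → ClassicalTerm → Set
    Supp t c = ¬ (coeff t c ≈ 0#)

    supp-≋ : ∀ {s t} c → s ≋ t → Supp s c → Supp t c
    supp-≋ c s≋t s≉0 t≈0 = s≉0 (trans (coeff-≋ s≋t c) t≈0)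

    supp-⌜⌝⁺ : ∀ u → Supp ⌜ u ⌝ (sub τ u)
    supp-⌜⌝⁺ u u≈0 = 1≉0 (trans (sym (coeff-⌜⌝-diag u)) u≈0)

    supp-⌜⌝⁻ : ∀ u {c} → Supp ⌜ u ⌝ c → sub τ u ≡ c
    supp-⌜⌝⁻ u u≉0 = decidable-stable em (u≉0 ∘ coeff-⌜⌝-off u)

    -- The converse fails in general, since the amplitude may vanish; in sums, coefficients may
    -- cancel. For an upper bound on supports this inclusion suffices.
    supp-· : ∀ α t {c} → Supp (α · t) c → Supp t c
    supp-· α t αt≉0 t≈0 = αt≉0 (trans (*-congˡ t≈0) (zeroʳ _))

    supp-⊕ : ∀ s t {c} → Supp (s ⊕ t) c → Supp s c ⊎ Supp t c
    supp-⊕ s t {c} s⊕t≉0 with em {P = coeff s c ≈ 0#}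
    ... | yes s≈0 = inj₂ λ t≈0 → s⊕t≉0 (trans (+-cong s≈0 t≈0) (+-identityˡ 0#))
    ... | no s≉0  = inj₁ s≉0

    supp-∑ : ∀ {n} (α : Fin (suc n) → Amplitude) t {c} → Supp (∑ α t) c → ∃ λ i → Supp (t i) c
    supp-∑ {zero}  α t ≉0 = zero , supp-· (α zero) (t zero) ≉0
    supp-∑ {suc n} α t ≉0 with supp-⊕ (α zero · t zero) (∑ (α ∘ suc) (t ∘ suc)) ≉0
    ... | inj₁ ≉0′ = zero , supp-· (α zero) (t zero) ≉0′
    ... | inj₂ ≉0′ = let i , ≉0″ = supp-∑ (α ∘ suc) (t ∘ suc) ≉0′ in suc i , ≉0″

    coeff-∑-zero : ∀ {n} (α : Fin (suc n) → Amplitude) t {c} → (∀ j → coeff (t j) c ≈ 0#) →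
                   coeff (∑ α t) c ≈ 0#
    coeff-∑-zero α t {c} t≈0 = decidable-stable em λ ≉0 →
      let i , ti≉0 = supp-∑ α t ≉0 in ti≉0 (t≈0 i)

    coeff-∑-single : ∀ {n} (α : Fin (suc n) → Amplitude) t {c} i →
                     (∀ j → i ≢ j → coeff (t j) c ≈ 0#) →
                     coeff (∑ α t) c ≈ eval (instᴬ ν (α i)) * coeff (t i) c
    coeff-∑-single {zero}  α t zero    t≈0 = refl
    coeff-∑-single {suc n} α t zero    t≈0 = trans
      (+-congˡ (coeff-∑-zero (α ∘ suc) (t ∘ suc) (λ j → t≈0 (suc j) λ ()))) (+-identityʳ _)
    coeff-∑-single {suc n} α t (suc i) t≈0 = trans
      (+-cong (trans (*-congˡ (t≈0 zero λ ())) (zeroʳ _))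
              (coeff-∑-single (α ∘ suc) (t ∘ suc) i (λ j i≢j → t≈0 (suc j) (i≢j ∘ Finₚ.suc-injective))))
      (+-identityˡ _)

    -- A finite superset of the support: amplitudes are ignored, so neither zero coefficients nor
    -- cancellations are detected.
    support  : Term → List ClassicalTerm
    support* : ∀ {n} → Vec Term n → List (Vec ClassicalTerm n)
    support (var x)    = τ x ∷ []
    support (app b ts) = List.map (app b) (support* ts)
    support (α · t)    = support t
    support (s ⊕ t)    = support s ++ support t
    support* []        = [] ∷ []
    support* (t ∷ ts)  = cartesianProductWith _∷_ (support t) (support* ts)

    supp⊆support  : ∀ t {c} → Supp t c → c ∈ support t
    supp*⊆support : ∀ {n} (ts : Vec Term n) {cs} → ¬ (coeff* ts cs ≈ 0#) → cs ∈ support* ts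
    supp⊆support (var x) {c} ≉0 with em {P = τ x ≡ c}
    ... | yes τx≡c = here (≡.sym τx≡c)
    ... | no _     = contradiction refl ≉0
    supp⊆support (app b ts) {c} ≉0 with em {P = HasHead b c}
    ... | yes (head cs) = ∈-map⁺ (app b) (supp*⊆support ts ≉0)
    ... | no _          = contradiction refl ≉0
    supp⊆support (α · t) ≉0 = supp⊆support t (supp-· α t ≉0)
    supp⊆support (s ⊕ t) ≉0 =
      [ ∈-++⁺ˡ ∘ supp⊆support s , ∈-++⁺ʳ (support s) ∘ supp⊆support t ]′ (supp-⊕ s t ≉0)
    supp*⊆support []       {[]}     ≉0 = here ≡.refl
    supp*⊆support (t ∷ ts) {c ∷ cs} ≉0 = ∈-cartesianProductWith⁺ _∷_
      (supp⊆support t λ t≈0 → ≉0 (trans (*-congʳ t≈0) (zeroˡ _)))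
      (supp*⊆support ts λ ts≈0 → ≉0 (trans (*-congˡ ts≈0) (zeroʳ _)))

-- Excluded middle decides types, not mere propositions, so its witnesses provide
-- the choices needed to build the infinite sequence.

noInfiniteChain⇒wellFounded :
  ExcludedMiddle 0ℓ → {A : Set} (_<_ : Rel A 0ℓ) →
  ¬ (∃ λ (f : ℕ → A) → ∀ n → f (suc n) < f n) → WellFounded _<_
noInfiniteChain⇒wellFounded em {A} _<_ noChain x = decidable-stable em λ ¬acc →
  noChain (proj₁ ∘ chain (x , ¬acc) , λ n → proj₂ (next (chain (x , ¬acc) n)))
  where
  NonAcc : Set
  NonAcc = ∃ λ x → ¬ Acc _<_ x

  next : ((x , _) : NonAcc) → ∃ λ ((y , _) : NonAcc) → y < x
  next (x , ¬acc) with em {P = ∃ λ ((y , _) : NonAcc) → y < x}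
  ... | yes found = found
  ... | no ¬found = contradiction
    (acc λ {y} y<x → decidable-stable em λ ¬acc-y → ¬found ((y , ¬acc-y) , y<x)) ¬acc

  chain : NonAcc → ℕ → NonAcc
  chain a zero    = a
  chain a (suc n) = proj₁ (next (chain a n))

-- Supports under substitution and reduction, and termination.

module Termination (em : ExcludedMiddle 0ℓ) (Sig : Signature) (K : Evaluation Sig) where

  open Syntax Sig
  open Evaluation K hiding (zero)
  open Coefficients em Sig K
  open SyntaxProperties Sig

  instᴺ-of-ground : ∀ ν ι → varsᴺ ι ≡ [] → instᴺ ν ι ≡ ι
  instᴺ-of-ground ν zero    _ = ≡.refl
  instᴺ-of-ground ν (suc ι) g = cong suc (instᴺ-of-ground ν ι g)

  instᴺ*-of-ground : ∀ ν {n} (ιs : Vec Natural n) → varsᴺ* ιs ≡ [] → map (instᴺ ν) ιs ≡ ιs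
  instᴺ*-of-ground ν []       _ = ≡.refl
  instᴺ*-of-ground ν (ι ∷ ιs) g = cong₂ _∷_
    (instᴺ-of-ground ν ι (++-conicalˡ (varsᴺ ι) _ g))
    (instᴺ*-of-ground ν ιs (++-conicalʳ (varsᴺ ι) _ g))

  instᴬ-of-ground : ∀ ν α → GroundAmplitude α → instᴬ ν α ≡ α
  instᴬ-of-ground ν (amp a ιs) g = cong (amp a) (instᴺ*-of-ground ν ιs g)
  instᴬ-of-ground ν (α · β)    g = cong₂ _·_
    (instᴬ-of-ground ν α (++-conicalˡ (varsᴬ α) _ g)) (instᴬ-of-ground ν β (++-conicalʳ (varsᴬ α) _ g))
  instᴬ-of-ground ν (α ⊕ β)    g = cong₂ _⊕_
    (instᴬ-of-ground ν α (++-conicalˡ (varsᴬ α) _ g)) (instᴬ-of-ground ν β (++-conicalʳ (varsᴬ α) _ g))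

  ν₀ : Variable → ℕ
  ν₀ _ = 0

  -- Holds at variables too, because `⟦_⟧ᴺ` gives them the same value 0 as `ν₀`.
  instᴺ-ν₀ : ∀ ι → instᴺ ν₀ ι ≡ numeral ⟦ ι ⟧ᴺ
  instᴺ-ν₀ (var x) = ≡.refl
  instᴺ-ν₀ zero    = ≡.refl
  instᴺ-ν₀ (suc ι) = cong suc (instᴺ-ν₀ ι)

  coeff-diag : ∀ ν u → coeff ν var ⌜ u ⌝ u ≈ 1#
  coeff-diag ν u =
    subst (λ d → coeff ν var ⌜ u ⌝ d ≈ 1#) (sub-var u) (coeff-⌜⌝-diag ν var u)

  coeff-⌜⌝ : ∀ ν u c → coeff ν var ⌜ u ⌝ c ≈ indicator (em {P = u ≡ c})
  coeff-⌜⌝ ν u c with em {P = u ≡ c}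
  ... | yes ≡.refl = coeff-diag ν u
  ... | no u≢c     = coeff-⌜⌝-off ν var u (u≢c ∘ ≡.trans (≡.sym (sub-var u)))

  -- A substitution read as a pair of assignments, as coefficients expect.

  module _ (σ : Assignment) where

    naturalPart : Variable → ℕ
    naturalPart x with em {P = ∃ λ ι → σ x ≡ ⌊ ι ⌋}
    ... | yes (ι , _) = ⟦ ι ⟧ᴺ
    ... | no _        = 0

    naturalPart-⌊⌋ : ∀ x ι → σ x ≡ ⌊ ι ⌋ → naturalPart x ≡ ⟦ ι ⟧ᴺ
    naturalPart-⌊⌋ x ι eq with em {P = ∃ λ ι → σ x ≡ ⌊ ι ⌋}
    ... | yes (κ , eq′) = cong ⟦_⟧ᴺ (⌊⌋-injective κ ι (≡.trans (≡.sym eq′) eq))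
    ... | no ¬nat       = contradiction (ι , eq) ¬nat

    -- The default term is a value, so the result is a substitution by classical values even where
    -- `σ` is superposed.
    classicalPart : Variable → ClassicalTerm
    classicalPart x with em {P = Classical (σ x)}
    ... | yes (c , _) = c
    ... | no _        = app (inj₁ 𝟎) []

    classicalPart-⌜⌝ : ∀ x → Classical (σ x) → σ x ≡ ⌜ classicalPart x ⌝
    classicalPart-⌜⌝ x cl with em {P = Classical (σ x)}
    ... | yes (_ , eq) = eq
    ... | no ¬cl       = contradiction cl ¬cl

    classicalPart-substitution : IsSubstitution σ → IsClassicalSubstitution (⌜_⌝ ∘ classicalPart)
    classicalPart-substitution σ-value x with em {P = Classical (σ x)}
    ... | yes (c , eq) = subst Value eq (σ-value x) , c , ≡.refl
    ... | no _         = con 𝟎 [] , app (inj₁ 𝟎) [] , ≡.refl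

    ↦ᴺ-inst : ∀ {ι κ} → ι [ σ ]↦ᴺ κ → instᴺ ν₀ κ ≡ instᴺ naturalPart ι
    ↦ᴺ-inst (var {x = x} {ι} eq) =
      ≡.trans (instᴺ-ν₀ ι) (cong numeral (≡.sym (naturalPart-⌊⌋ x ι eq)))
    ↦ᴺ-inst zero    = ≡.refl
    ↦ᴺ-inst (suc p) = cong suc (↦ᴺ-inst p)

    ↦ᴺ*-inst : ∀ {n} {ιs κs : Vec Natural n} → Pointwise (_[ σ ]↦ᴺ_) ιs κs →
               map (instᴺ ν₀) κs ≡ map (instᴺ naturalPart) ιs
    ↦ᴺ*-inst []       = ≡.refl
    ↦ᴺ*-inst (p ∷ ps) = cong₂ _∷_ (↦ᴺ-inst p) (↦ᴺ*-inst ps)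

    ↦ᴬ-inst : ∀ {α β} → α [ σ ]↦ᴬ β → instᴬ ν₀ β ≡ instᴬ naturalPart α
    ↦ᴬ-inst (amp ps) = cong (amp _) (↦ᴺ*-inst ps)
    ↦ᴬ-inst (p · q)  = cong₂ _·_ (↦ᴬ-inst p) (↦ᴬ-inst q)
    ↦ᴬ-inst (p ⊕ q)  = cong₂ _⊕_ (↦ᴬ-inst p) (↦ᴬ-inst q)

    -- Carries facts about a rule over to its instances. Classicality of `σ x` makes it a basis
    -- vector, which is how `coeff` treats a variable.
    coeff-↦  : ∀ {t w} → t [ σ ]↦ w → (∀ {x} → x ∈ vars t → Classical (σ x)) →
               ∀ c → coeff ν₀ var w c ≈ coeff naturalPart classicalPart t c
    coeff*-↦ : ∀ {n} {ts ws : Vec Term n} → Pointwise (_[ σ ]↦_) ts ws →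
               (∀ {x} → x ∈ vars* ts → Classical (σ x)) →
               ∀ cs → coeff* ν₀ var ws cs ≈ coeff* naturalPart classicalPart ts cs
    coeff-↦ (var {x = x}) cl c = trans
      (reflexive (cong (λ w → coeff ν₀ var w c) (classicalPart-⌜⌝ x (cl (here ≡.refl)))))
      (coeff-⌜⌝ ν₀ (classicalPart x) c)
    coeff-↦ (app ps) cl c = onHead-cong em (coeff*-↦ ps cl)
    coeff-↦ (_·_ {α = α} p q) cl c =
      *-cong (reflexive (cong eval (↦ᴬ-inst p))) (coeff-↦ q (cl ∘ ∈-++⁺ʳ (varsᴬ α)) c)
    coeff-↦ (_⊕_ {s = s} p q) cl c =
      +-cong (coeff-↦ p (cl ∘ ∈-++⁺ˡ) c) (coeff-↦ q (cl ∘ ∈-++⁺ʳ (vars s)) c)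
    coeff*-↦ []                 cl []       = refl
    coeff*-↦ (_∷_ {x = t} p ps) cl (c ∷ cs) =
      *-cong (coeff-↦ p (cl ∘ ∈-++⁺ˡ) c) (coeff*-↦ ps (cl ∘ ∈-++⁺ʳ (vars t)) cs)

    supp-↦ : ∀ {t w} → t [ σ ]↦ w → (∀ {x} → x ∈ vars t → Classical (σ x)) →
             ∀ c → Supp ν₀ var w c → Supp naturalPart classicalPart t c
    supp-↦ p cl c w≉0 t≈0 = w≉0 (trans (coeff-↦ p cl c) t≈0)

  ⌜⌝-↦  : ∀ τ u → ⌜ u ⌝ [ ⌜_⌝ ∘ τ ]↦ ⌜ sub τ u ⌝
  ⌜⌝*-↦ : ∀ τ {n} (us : Vec ClassicalTerm n) →
          Pointwise (_[ ⌜_⌝ ∘ τ ]↦_) ⌜ us ⌝* ⌜ sub* τ us ⌝*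
  ⌜⌝-↦ τ (var x)    = var
  ⌜⌝-↦ τ (app b us) = app (⌜⌝*-↦ τ us)
  ⌜⌝*-↦ τ []        = []
  ⌜⌝*-↦ τ (u ∷ us)  = ⌜⌝-↦ τ u ∷ ⌜⌝*-↦ τ us

  -- A ground instance by `σ` depends only on the naturals that `σ` puts into `α`, hence equals the
  -- instance by `naturalPart σ` in value.
  inst-zero⇒≐0 : ∀ α → (∀ ν → eval (instᴬ ν α) ≈ 0#) → ⟦ α ⟧≐ Complex.0ℂ
  inst-zero⇒≐0 α α≈0 σ _ β α↦β β-ground = 0-eval β
    (trans (reflexive (cong eval (≡.trans (≡.sym (instᴬ-of-ground ν₀ β β-ground)) (↦ᴬ-inst σ α↦β))))
           (α≈0 (naturalPart σ)))

  -- Canonical forms and their supports.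

  coeff-canonical : ∀ ν {n} (α : Fin (suc n) → Amplitude) u → Canonical α u → ∀ i →
                    coeff ν var (∑ α (⌜_⌝ ∘ u)) (u i) ≈ eval (instᴬ ν (α i))
  coeff-canonical ν α u can i = trans
    (coeff-∑-single ν var α (⌜_⌝ ∘ u) i λ j i≢j → coeff-⌜⌝-off ν var (u j) λ eq →
      i≢j (≡.sym (Canonical.distinct can (≡.trans (≡.sym (sub-var (u j))) eq))))
    (trans (*-congˡ (coeff-diag ν (u i))) (*-identityʳ _))

  -- If `u i` differed from `l`, its coefficient, which is that of `α i`, would be 0 under every
  -- `ν`, so `α i` would be 0. One `ν` would not do: a nonzero amplitude with variables may vanish
  -- under some instances.
  canonical-classical : ∀ {n} l (α : Fin (suc n) → Amplitude) u → ⌜ l ⌝ ≋ ∑ α (⌜_⌝ ∘ u) →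
                        Canonical α u → ∀ i → u i ≡ l
  canonical-classical l α u l≋∑ can i = decidable-stable em λ ui≢l →
    Canonical.nonzero can i (inst-zero⇒≐0 (α i) λ ν →
      trans (sym (coeff-canonical ν α u can i))
        (trans (sym (coeff-≋ ν var l≋∑ (u i)))
          (coeff-⌜⌝-off ν var l λ eq → ui≢l (≡.trans (≡.sym eq) (sub-var l)))))

  infix 4 _∈supp_

  _∈supp_ : ClassicalTerm → Term → Set
  c ∈supp t = Supp ν₀ var t c

  ∈supp-⌜⌝⁺ : ∀ u → u ∈supp ⌜ u ⌝
  ∈supp-⌜⌝⁺ u = subst (Supp ν₀ var ⌜ u ⌝) (sub-var u) (supp-⌜⌝⁺ ν₀ var u)

  ∈supp-⌜⌝⁻ : ∀ u {c} → c ∈supp ⌜ u ⌝ → u ≡ c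
  ∈supp-⌜⌝⁻ u c∈ = ≡.trans (≡.sym (sub-var u)) (supp-⌜⌝⁻ ν₀ var u c∈)

  ∑-ground : ∀ {n} (α : Fin (suc n) → Amplitude) t → Ground (∑ α t) → ∀ i →
             GroundAmplitude (α i)
  ∑-ground {zero}  α t g zero    = ++-conicalˡ (varsᴬ (α zero)) _ g
  ∑-ground {suc n} α t g zero    =
    ++-conicalˡ (varsᴬ (α zero)) _ (++-conicalˡ (vars (α zero · t zero)) _ g)
  ∑-ground {suc n} α t g (suc i) =
    ∑-ground (α ∘ suc) (t ∘ suc) (++-conicalʳ (vars (α zero · t zero)) _ g) i

  -- Ground amplitudes have the same instance under every `ν`, so being nonzero already shows at
  -- `ν₀`.
  ∈supp-canonical : ∀ {n} (α : Fin (suc n) → Amplitude) u → Canonical α u →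
                    Ground (∑ α (⌜_⌝ ∘ u)) → ∀ i → u i ∈supp ∑ α (⌜_⌝ ∘ u)
  ∈supp-canonical α u can g i ≈0 = Canonical.nonzero can i (inst-zero⇒≐0 (α i) λ ν →
    trans (reflexive (cong eval (≡.trans (ground ν) (≡.sym (ground ν₀)))))
      (trans (sym (coeff-canonical ν₀ α u can i)) ≈0))
    where
    ground : ∀ ν → instᴬ ν (α i) ≡ α i
    ground ν = instᴬ-of-ground ν (α i) (∑-ground α (⌜_⌝ ∘ u) g i)

  -- The arguments away from `i` are classical and contribute one basis vector each, so
  -- superposition comes from `q` alone. The equation with `p` expresses this whatever `ts` holds at
  -- `i`.
  supp*-update : ∀ {n} (ts : Vec Term n) i {p} es → ts [ i ]≔ p ≡ ⌜ es ⌝* → ∀ q cs →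
                 ¬ (coeff* ν₀ var (ts [ i ]≔ q) cs ≈ 0#) →
                 ∃ λ d → d ∈supp q × cs ≡ es [ i ]≔ d
  supp*-update (t ∷ ts) zero    (e ∷ es) eq q (c ∷ cs) ≉0 =
    c , (λ q≈0 → ≉0 (trans (*-congʳ q≈0) (zeroˡ _))) , cong (c ∷_) (decidable-stable em λ cs≢es →
      ≉0 (trans (*-congˡ (ts≈0 cs≢es)) (zeroʳ _)))
    where
    ts≈0 : cs ≢ es → coeff* ν₀ var ts cs ≈ 0#
    ts≈0 cs≢es rewrite proj₂ (∷-injective eq) =
      coeff*-⌜⌝-off ν₀ var es (cs≢es ∘ ≡.sym ∘ ≡.trans (≡.sym (sub*-var es)))
  supp*-update (t ∷ ts) (suc i) (e ∷ es) eq q (c ∷ cs) ≉0 =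
    let t≡e , eq′     = ∷-injective eq
        d , d∈q , cs≡ = supp*-update ts i es eq′ q cs λ ts≈0 → ≉0 (trans (*-congˡ ts≈0) (zeroʳ _))
        e≡c           = ∈supp-⌜⌝⁻ e (subst (c ∈supp_) t≡e
                          λ t≈0 → ≉0 (trans (*-congʳ t≈0) (zeroˡ _)))
    in d , d∈q , cong₂ _∷_ (≡.sym e≡c) cs≡

  update-classical : ∀ {n} (ts : Vec Term n) i {p} es → ts [ i ]≔ p ≡ ⌜ es ⌝* →
                     p ≡ ⌜ lookup es i ⌝
  update-classical (_ ∷ ts) zero    (e ∷ es) eq = proj₁ (∷-injective eq)
  update-classical (_ ∷ ts) (suc i) (e ∷ es) eq = update-classical ts i es (proj₂ (∷-injective eq))

  -- Decrease of the order along contractions.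

  module _ (_⪰_ : Rel ClassicalTerm 0ℓ) (isRewriteOrder : IsRewriteOrder (Strict _⪰_)) where

    open IsRewriteOrder isRewriteOrder

    _≻_ : Rel ClassicalTerm 0ℓ
    _≻_ = Strict _⪰_

    -- The "some" case changes nothing: a canonical form of a classical term has
    -- that term as its only summand.

    worstPath-supp : ∀ {s r} l → s ≡ ⌜ l ⌝ → WorstPath _⪰_ s r → ¬ WorstPath _⪰_ r ⌜ l ⌝ →
                     ∀ ν τ c → Supp ν τ r c → ∃ λ u → l ≻ u × sub τ u ≡ c
    worstPath-supp l eq (classical {s} {t} s⪰t) r⋡l ν τ c c∈r with ⌜⌝-injective s l eq
    ... | ≡.refl = t , (s⪰t , r⋡l ∘ classical) , supp-⌜⌝⁻ ν τ t c∈r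
    worstPath-supp l ≡.refl (some {α = α} {u} s≋∑ can (i , ui⪰r)) =
      worstPath-supp l (cong ⌜_⌝ (canonical-classical l α u s≋∑ can i)) ui⪰r
    worstPath-supp l eq (all {β = β} {u} r≋∑ can l⪰u) r⋡l ν τ c c∈r =
      let j , c∈uj = supp-∑ ν τ β (⌜_⌝ ∘ u) (supp-≋ ν τ c r≋∑ c∈r)
      in worstPath-supp l eq (l⪰u j) (λ uj⪰l → r⋡l (some r≋∑ can (j , uj⪰l))) ν τ c c∈uj

    -- Each layer of the context adds one use of monotonicity, applied separately to every element
    -- of the support.
    plug-decreasing : ∀ E {l r} e → plug E l ≡ ⌜ e ⌝ →
                      (∀ d → l ≡ ⌜ d ⌝ → ∀ c → c ∈supp r → d ≻ c) →
                      ∀ c → c ∈supp plug E r → e ≻ c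
    plug-decreasing ◇ e eq l≻r = l≻r e eq
    plug-decreasing (app b ts i _ E) {l} {r} (app b′ es) eq l≻r c c∈ with app≡app eq
    ... | ≡.refl , eq′ with em {P = HasHead b c}
    ...   | no _ = contradiction refl c∈
    ...   | yes (head cs) =
      let d , d∈ , cs≡ = supp*-update ts i es eq′ (plug E r) cs c∈
          ei≻d         = plug-decreasing E (lookup es i) (update-classical ts i es eq′) l≻r d d∈
      -- Monotonicity compares two updates of `es`; updating by its own entry gives `es` back.
      in ≡.subst₂ _≻_ (cong (app b) ([]≔-lookup es i)) (cong (app b) (≡.sym cs≡))
           (monotonic b es i ei≻d)

    -- Contraction of a classical term by a rule.

    module _ (R : STRS) (compatible : Compatible R (Strict (WorstPath _⪰_))) where

      open STRS R

      lhs-classical : ∀ {l r} → Rules l r → Classical l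
      lhs-classical rule with isRule rule
      ... | record { f = f ; lhs = ≡.refl ; patterns = patterns } =
        let cs , eq = pattern-classical* patterns in app (inj₂ f) cs , cong (app (inj₂ f)) eq

      -- A classical redex forces `σ` to be classical on the variables of `l`, hence on those of
      -- `r`. Each `c` is then an instance of some `u` with `l` ≻ `u`, and closure under
      -- substitutions applies.
      rule-decreasing : ∀ {l r σ l′ r′} → Rules l r → IsSubstitution σ → l [ σ ]↦ l′ → r [ σ ]↦ r′ →
                        ∀ e → l′ ≡ ⌜ e ⌝ → ∀ c → c ∈supp r′ → e ≻ c
      rule-decreasing {l} {r} {σ} rule σ-value l↦ r↦ e ≡.refl c c∈r′ with lhs-classical rule
      ... | lᶜ , ≡.refl =
        let l-cl           = ↦-classical e l↦ ≡.refl
            τ              = classicalPart σ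
            l⪰r , r⋡l      = compatible rule
            u , l≻u , uτ≡c = worstPath-supp lᶜ ≡.refl l⪰r r⋡l (naturalPart σ) τ c
                               (supp-↦ σ r↦ (l-cl ∘ IsRule.varsr⊆l (isRule rule)) c c∈r′)
            lτ≡e           = supp-⌜⌝⁻ (naturalPart σ) τ lᶜ (supp-↦ σ l↦ l-cl e (∈supp-⌜⌝⁺ e))
        -- `σ` may be superposed on other variables, so its classical part takes its place.
        in ≡.subst₂ _≻_ lτ≡e uτ≡c (closedUnderSubstitutions (⌜_⌝ ∘ τ)
             (classicalPart-substitution σ σ-value) (⌜⌝-↦ τ lᶜ) (⌜⌝-↦ τ u) l≻u)

      -- An instance of `ruleC`, free of any reference to normal forms. Source and target are given
      -- by equations, so that two contractions of one term can be compared.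
      data Contracts (e : ClassicalTerm) (t : Term) : Set where
        contract : ∀ {l r σ l′ r′} E → Rules l r → IsSubstitution σ → l [ σ ]↦ l′ → r [ σ ]↦ r′ →
                   plug E l′ ≡ ⌜ e ⌝ → t ≡ plug E r′ → Ground ⌜ e ⌝ → Ground t → Contracts e t

      contracts-decreasing : ∀ {e t} → Contracts e t → ∀ c → c ∈supp t → e ≻ c
      contracts-decreasing {e} (contract E rule σ-value l↦ r↦ eq ≡.refl _ _) =
        plug-decreasing E e eq (rule-decreasing rule σ-value l↦ r↦)

      redex-call : ∀ {l r σ l′} → Rules l r → IsSubstitution σ → l [ σ ]↦ l′ → Call l′
      redex-call rule σ-value l↦ with isRule rule
      redex-call rule σ-value (app ps↦) | record { f = f ; lhs = ≡.refl ; patterns = patterns } =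
        call f (pattern-value* σ-value patterns ps↦)

      lhs-subterm : ∀ {l r} → Rules l r → NonVariableSubterm l l
      lhs-subterm rule with isRule rule
      ... | record { lhs = ≡.refl } = here

      -- The term determines context and redex, non-overlapping at the root determines the rule, and
      -- the redex determines the substitution on the variables of `l`, which include those of `r`.
      contracts-deterministic : ∀ {e t₁ t₂} → Contracts e t₁ → Contracts e t₂ → t₁ ≡ t₂
      contracts-deterministic
        (contract E₁ rule₁ σ₁-value l₁↦ r₁↦ eq₁ ≡.refl _ _)
        (contract E₂ rule₂ σ₂-value l₂↦ r₂↦ eq₂ ≡.refl _ _)
        with plug-unique E₁ E₂ (redex-call rule₁ σ₁-value l₁↦) (redex-call rule₂ σ₂-value l₂↦)
               (≡.trans eq₁ (≡.sym eq₂))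
      ... | ≡.refl , plug≡ with nonOverlapping rule₁ rule₂ (lhs-subterm rule₁) l₁↦ l₂↦
      ...   | _ , ≡.refl , ≡.refl = ≡.trans
        (cong (plug E₁) (↦-unique r₁↦ r₂↦
          (↦-agree l₁↦ l₂↦ ≡.refl ∘ IsRule.varsr⊆l (isRule rule₁))))
        (plug≡ _)

      -- Effect of a reduction step on the support.

      -- Under `ruleE` the supports do not change; under `ruleQ` the origin of `c` is a summand, and
      -- the summands of a ground canonical form all lie in its support.
      step-supp : ∀ {NF : Pred Term 0ℓ} {s t} → Step R NF s t → ∀ c → c ∈supp t →
                  ∃ λ e → e ∈supp s ×
                    ((NF ⌜ e ⌝ × e ≡ c) ⊎ ∃ λ t′ → Contracts e t′ × c ∈supp t′)
      step-supp (ruleC E rule σ-value l↦ r↦ (e , eq) gₗ gᵣ) c c∈ =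
        e , subst (e ∈supp_) (≡.sym eq) (∈supp-⌜⌝⁺ e) ,
        inj₂ (_ , contract E rule σ-value l↦ r↦ eq ≡.refl (subst Ground eq gₗ) gᵣ , c∈)
      step-supp (ruleE s≋s′ step t′≋t _ _) c c∈ =
        let e , e∈s′ , cases = step-supp step c (supp-≋ ν₀ var c (≋-sym t′≋t) c∈)
        in e , supp-≋ ν₀ var e (≋-sym s≋s′) e∈s′ , cases
      step-supp (ruleQ {α = α} {s} {t} can steps _ gₛ gₜ) c c∈ with supp-∑ ν₀ var α t c∈
      ... | i , c∈ti with steps i
      ...   | inj₁ (nf , ti≡si) = s i , ∈supp-canonical α s can gₛ i ,
        inj₁ (nf , ∈supp-⌜⌝⁻ (s i) (subst (c ∈supp_) ti≡si c∈ti))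
      ...   | inj₂ step with step-supp step c c∈ti
      -- The step from this summand may itself use `ruleE` or `ruleQ`, but its source has `s i` as
      -- its only support element.
      ...     | e , e∈si , cases with ∈supp-⌜⌝⁻ (s i) e∈si
      ...       | ≡.refl = s i , ∈supp-canonical α s can gₛ i , cases

      -- `ruleQ` requires some summand to step, so no reduction step merely keeps normal forms.
      step-contracts : ∀ {NF : Pred Term 0ℓ} {s t} → Step R NF s t →
                       ∃ λ e → e ∈supp s × ∃ (Contracts e)
      step-contracts (ruleC E rule σ-value l↦ r↦ (e , eq) gₗ gᵣ) =
        e , subst (e ∈supp_) (≡.sym eq) (∈supp-⌜⌝⁺ e) ,
        _ , contract E rule σ-value l↦ r↦ eq ≡.refl (subst Ground eq gₗ) gᵣ
      step-contracts (ruleE s≋s′ step _ _ _) =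
        let e , e∈s′ , e⇒ = step-contracts step in e , supp-≋ ν₀ var e (≋-sym s≋s′) e∈s′ , e⇒
      step-contracts (ruleQ {α = α} {s} can _ (i , step) gₛ _) with step-contracts step
      ... | e , e∈si , e⇒ with ∈supp-⌜⌝⁻ (s i) e∈si
      ...   | ≡.refl = s i , ∈supp-canonical α s can gₛ i , e⇒

      -- Bounds on contraction sequences.

      -- At most `k` contractions occur along any path that picks an element of the support after
      -- each contraction.
      Bounded : ℕ → Pred ClassicalTerm 0ℓ
      Bounded zero    e = ∀ t → ¬ Contracts e t
      Bounded (suc k) e = ∀ t → Contracts e t → ∀ c → c ∈supp t → Bounded k c

      normal⇒bounded : ∀ k {e} → (∀ t → ¬ Contracts e t) → Bounded k e
      normal⇒bounded zero    nf         = nf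
      normal⇒bounded (suc k) nf t e⇒t   = contradiction e⇒t (nf t)

      bounded-mono : ∀ {k m e} → k ≤ m → Bounded k e → Bounded m e
      bounded-mono {m = m} z≤n       nf = normal⇒bounded m nf
      bounded-mono         (s≤s k≤m) bd t e⇒t c c∈t = bounded-mono k≤m (bd t e⇒t c c∈t)

      -- `P` singles out the members of the list that have a bound, since `support` may list terms
      -- outside the support.
      bounded-list : (P : Pred ClassicalTerm 0ℓ) → (∀ c → P c → ∃ λ k → Bounded k c) →
                     ∀ cs → ∃ λ k → ∀ {c} → c ∈ cs → P c → Bounded k c
      bounded-list P bd []       = 0 , λ ()
      bounded-list P bd (c ∷ cs) with bounded-list P bd cs | em {P = P c}
      ... | k , bd* | no ¬pc = k , λ where
        (here ≡.refl) pc → contradiction pc ¬pc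
        (there c∈)    pc → bd* c∈ pc
      ... | k , bd* | yes pc = let m , bd-c = bd c pc in m ⊔ k , λ where
        (here ≡.refl) _ → bounded-mono (ℕₚ.m≤m⊔n m k) bd-c
        (there c∈)    p → bounded-mono (ℕₚ.m≤n⊔m m k) (bd* c∈ p)

      bounded-supp : ∀ t → (∀ c → c ∈supp t → ∃ λ k → Bounded k c) →
                     ∃ λ k → ∀ c → c ∈supp t → Bounded k c
      bounded-supp t bd =
        let k , bd* = bounded-list (_∈supp t) bd (support ν₀ var t)
        in k , λ c c∈t → bd* (supp⊆support ν₀ var t c∈t) c∈t

      acc⇒bounded : ∀ {e} → Acc (λ d c → c ≻ d) e → ∃ λ k → Bounded k e
      acc⇒bounded {e} (acc rec) with em {P = ∃ (Contracts e)}
      ... | no nf         = 0 , λ t e⇒t → nf (t , e⇒t)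
      ... | yes (t , e⇒t) =
        let k , bd = bounded-supp t λ c c∈t → acc⇒bounded (rec (contracts-decreasing e⇒t c c∈t))
        -- By determinism the bound for the support of `t` serves every contractum `t′`; the
        -- successor counts the contraction itself.
        in suc k , λ t′ e⇒t′ c c∈t′ →
             bd c (subst (c ∈supp_) (contracts-deterministic e⇒t′ e⇒t) c∈t′)

      -- Lengths of reduction chains.

      module _ {_⟶_ : Rel Term 0ℓ} (isReduction : IsReduction R _⟶_) where

        -- A contraction is an instance of `ruleC`, and the specification of the reduction turns it
        -- into a reduct.
        normalForm⇒¬contracts : ∀ {e} → NormalForm _⟶_ ⌜ e ⌝ → ∀ t → ¬ Contracts e t
        normalForm⇒¬contracts {e} (_ , nf) t (contract E rule σ-value l↦ r↦ eq ≡.refl gₗ gᵣ) =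
          nf (t , Equivalence.from (isReduction ⌜ e ⌝ t)
            (subst (λ s → Step R (NormalForm _⟶_) s t) eq
              (ruleC E rule σ-value l↦ r↦ (e , eq) (subst Ground (≡.sym eq) gₗ) gᵣ)))

        chain-bounded : ∀ {n s t} k → (∀ c → c ∈supp s → Bounded k c) → Chain _⟶_ n s t → n ≤ k
        chain-bounded k bd [] = z≤n
        chain-bounded k bd (_∷_ {s = s} {t} s⟶t chain)
          with Equivalence.to (isReduction s t) s⟶t
        chain-bounded zero    bd (s⟶t ∷ chain) | step =
          let e , e∈s , t′ , e⇒t′ = step-contracts step in contradiction e⇒t′ (bd e e∈s t′)
        chain-bounded (suc k) bd (_∷_ {t = t} s⟶t chain) | step =
          s≤s (chain-bounded k bounded-t chain)
          where
          bounded-t : ∀ c → c ∈supp t → Bounded k c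
          bounded-t c c∈t with step-supp step c c∈t
          -- A kept normal form satisfies every bound, so it also survives the passage from `suc k`
          -- to `k`.
          ... | e , e∈s , inj₁ (nf , ≡.refl)       = normal⇒bounded k (normalForm⇒¬contracts nf)
          ... | e , e∈s , inj₂ (t′ , e⇒t′ , c∈t′) = bd e e∈s t′ e⇒t′ c c∈t′

      terminating : WellFounded (λ d c → c ≻ d) → Terminating R
      terminating wf _⟶_ isReduction s _ =
        let k , bd = bounded-supp s λ c _ → acc⇒bounded (wf c)
        in k , λ chain → chain-bounded isReduction k bd chain

theorem31 : ExcludedMiddle 0ℓ →
    (Sig : Signature) → let open Syntax Sig in
    (_⪰_ : Rel ClassicalTerm 0ℓ) →
    IsPreorder _≡_ _⪰_ →
    NoInfiniteChain (Strict _⪰_) →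
    IsRewriteOrder (Strict _⪰_) →
    (R : STRS) →
    Compatible R (Strict (WorstPath _⪰_)) →
    Terminating R
theorem31 em Sig _⪰_ _ noChain isRewriteOrder R compatible =
  terminating _⪰_ isRewriteOrder R compatible
    (noInfiniteChain⇒wellFounded em (λ d c → Syntax.Strict Sig _⪰_ c d) noChain)
  where open Termination em Sig (complexEvaluation Sig)
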